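{- Let $p$ be a fixed prime and let $\Lambda(\mathbf{x})\in\mathbb{Z}_p[x_1^{\pm1},\dots,x_d^{\pm1}]$ be a Laurent polynomial whose Newton polyhedron contains the origin as its only interior integral point. Define $A(n)$, for $n\in\mathbb{N}$, as the constant term of $\Lambda(\mathbf{x})^n$. Assume that the generating function $f_A(z)=\sum_{n\ge0}A(n)z^n$ is annihilated by a differential operator $\mathcal{L}\in\mathbb{Z}_p[z,\theta]$ such that at least one of the following holds: (i) $\mathcal{L}$ is of type I; (ii) $\mathcal{L}$ is of type II and $p-1\in\mathcal{Z}_p(A)$. Then for all $n\in\mathbb{N}$, $A(n)\in p^{\alpha_p(A,n)}\mathbb{Z}_p$.
   Context: $\mathbb{Z}_p$ is the ring of $p$-adic integers. For a $\mathbb{Z}_p$-valued sequence $A$, $\mathcal{Z}_p(A)$ is the set of $v\in\{0,\dots,p-1\}$ with $A(v)\in p\mathbb{Z}_p$, and for $n\in\mathbb{N}$ with base-$p$ expansion $n=\sum_{k=0}^N n_kp^k$ ($n_k\in\{0,\dots,p-1\}$, $n_N\ne0$; for $n=0$ the single digit $0$), $\alpha_p(A,n)$ is the number of $k$ with $n_k\in\mathcal{Z}_p(A)$. $\theta=z\frac{d}{dz}$. An operator $\mathcal{L}=\sum_{k=0}^q z^kP_k(\theta)$ with $P_k\in\mathbb{Z}_p[X]$ is of type I if $P_0(\mathbb{Z}_p^\times)\subset\mathbb{Z}_p^\times$ and $P_k(X)\in\prod_{i=1}^{k-1}(X+i)^2\,\mathbb{Z}_p[X]$ for all $k\in\{2,\dots,q\}$;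 it is of type II if $q=2$, $P_0(\mathbb{Z}_p^\times)\subset\mathbb{Z}_p^\times$ and $P_2(X)\in(X+1)\mathbb{Z}_p[X]$. -}

module Defs where

open import Data.Nat as ℕ using (ℕ; zero; suc; _^_; _∸_)
open import Data.Nat.DivMod using (_/_; _%_)
open import Data.Integer as ℤ using (ℤ; +_)
open import Data.Integer.Divisibility using () renaming (_∣_ to _∣ℤ_)
open import Data.Rational as ℚ using (ℚ; 0ℚ; 1ℚ)
open import Data.List as List using (List; []; _∷_; length; concatMap; foldr)
open import Data.List.Relation.Unary.All using (All)
open import Data.Vec as Vec using (Vec)
import Data.Vec.Properties as VecP
open import Data.Fin using (Fin)
open import Data.Product using (Σ; _×_; _,_; proj₁; proj₂)
open import Data.Bool using (Bool; true; false; if_then_else_)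
open import Relation.Nullary using (¬_; does)
open import Relation.Binary.PropositionalEquality using (_≡_)

-- p-adic integers, modelled as the inverse limit lim Z/p^k Z :
-- an element is a sequence x : ℕ → ℤ (x k = representative mod p^k)
-- satisfying the coherence condition IsZp; two elements are equal
-- iff x ≈[ p ] y.  Ring operations are pointwise.

Zp : Set
Zp = ℕ → ℤ

cst : ℤ → Zp
cst z _ = z

0p 1p : Zp
0p = cst (+ 0)
1p = cst (+ 1)

_⊕_ _⊗_ : Zp → Zp → Zp
(x ⊕ y) k = x k ℤ.+ y k
(x ⊗ y) k = x k ℤ.* y k
infixl 6 _⊕_
infixl 7 _⊗_

IsZp : ℕ → Zp → Set
IsZp p x = ∀ k → (+ (p ^ k)) ∣ℤ (x (suc k) ℤ.- x k)

_≈[_]_ : Zp → ℕ → Zp → Set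
x ≈[ p ] y = ∀ k → (+ (p ^ k)) ∣ℤ (x k ℤ.- y k)

IsUnit : ℕ → Zp → Set
IsUnit p u = Σ Zp λ v → IsZp p v × ((u ⊗ v) ≈[ p ] 1p)

InPowIdeal : ℕ → ℕ → Zp → Set
InPowIdeal p a x = Σ Zp λ y → IsZp p y × (x ≈[ p ] (cst (+ (p ^ a)) ⊗ y))

-- Polynomials in Z_p[X]: coefficient lists, constant term first.

Poly : Set
Poly = List Zp

coeff : Poly → ℕ → Zp
coeff []       _       = 0p
coeff (c ∷ cs) zero    = c
coeff (c ∷ cs) (suc j) = coeff cs j

_+ₚ_ : Poly → Poly → Poly
[]       +ₚ q        = q
(a ∷ as) +ₚ []       = a ∷ as
(a ∷ as) +ₚ (b ∷ bs) = (a ⊕ b) ∷ (as +ₚ bs)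

scaleₚ : Zp → Poly → Poly
scaleₚ c = List.map (c ⊗_)

_*ₚ_ : Poly → Poly → Poly
[]       *ₚ q = []
(a ∷ as) *ₚ q = scaleₚ a q +ₚ (0p ∷ (as *ₚ q))

eval : Poly → Zp → Zp
eval []       x = 0p
eval (c ∷ cs) x = c ⊕ x ⊗ eval cs x

X+ : ℕ → Poly
X+ i = cst (+ i) ∷ 1p ∷ []

prodSq : ℕ → Poly
prodSq zero          = 1p ∷ []
prodSq (suc zero)    = 1p ∷ []
prodSq (suc (suc m)) = prodSq (suc m) *ₚ (X+ (suc m) *ₚ X+ (suc m))

PolyDivisible : ℕ → Poly → Poly → Set
PolyDivisible p D P =
  Σ Poly λ Q → All (IsZp p) Q × (∀ j → coeff P j ≈[ p ] coeff (D *ₚ Q) j)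

-- Differential operators  L = Σ_{k=0}^q z^k P_k(θ), given as [P_0,…,P_q].

Op : Set
Op = List Poly

nth : Op → ℕ → Poly
nth []       _       = []
nth (P ∷ Ps) zero    = P
nth (P ∷ Ps) (suc k) = nth Ps k

ordZ : Op → ℕ
ordZ L = length L ∸ 1

Series : Set
Series = ℕ → Zp

-- P(θ) acting on Σ f(n) z^n gives Σ P(n) f(n) z^n
applyPθ : Poly → Series → Series
applyPθ P f n = eval P (cst (+ n)) ⊗ f n

zshift : ℕ → Series → Series
zshift k g m = if does (k ℕ.≤? m) then g (m ∸ k) else 0p

_⊕ₛ_ : Series → Series → Series
(f ⊕ₛ g) n = f n ⊕ g n

applyOpFrom : ℕ → Op → Series → Series
applyOpFrom k []       f = λ _ → 0p
applyOpFrom k (P ∷ Ps) f = zshift k (applyPθ P f) ⊕ₛ applyOpFrom (suc k) Ps f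

applyOp : Op → Series → Series
applyOp = applyOpFrom 0

Annihilates : ℕ → Op → Series → Set
Annihilates p L f = ∀ m → applyOp L f m ≈[ p ] 0p

UnitPreserving : ℕ → Poly → Set
UnitPreserving p P = ∀ u → IsZp p u → IsUnit p u → IsUnit p (eval P u)

TypeI : ℕ → Op → Set
TypeI p L = UnitPreserving p (nth L 0)
          × (∀ k → 2 ℕ.≤ k → k ℕ.≤ ordZ L → PolyDivisible p (prodSq k) (nth L k))

TypeII : ℕ → Op → Set
TypeII p L = (length L ≡ 3)  -- q = 2
           × UnitPreserving p (nth L 0)
           × PolyDivisible p (X+ 1) (nth L 2)

-- Laurent polynomials in Z_p[x_1^{±1},…,x_d^{±1}] as formal sums of
-- monomials (exponent vector, coefficient).

Laurent : ℕ → Set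
Laurent d = List (Vec ℤ d × Zp)

mulL : ∀ {d} → Laurent d → Laurent d → Laurent d
mulL A B = concatMap (λ t → List.map (λ s → Vec.zipWith ℤ._+_ (proj₁ t) (proj₁ s) , proj₂ t ⊗ proj₂ s) B) A

powL : ∀ {d} → Laurent d → ℕ → Laurent d
powL Λ zero    = (Vec.replicate _ (+ 0) , 1p) ∷ []
powL Λ (suc n) = mulL (powL Λ n) Λ

coeffL : ∀ {d} → Laurent d → Vec ℤ d → Zp
coeffL Λ e = foldr (λ t acc → (if does (VecP.≡-dec ℤ._≟_ (proj₁ t) e) then proj₂ t else 0p) ⊕ acc) 0p Λ

constTerm : ∀ {d} → Laurent d → Zp
constTerm Λ = coeffL Λ (Vec.replicate _ (+ 0))

seqA : ∀ {d} → Laurent d → ℕ → Zp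
seqA Λ n = constTerm (powL Λ n)

InSupp : ∀ {d} → ℕ → Laurent d → Vec ℤ d → Set
InSupp p Λ e = ¬ (coeffL Λ e ≈[ p ] 0p)

-- Newton polyhedron = convex hull of the support (rational points).

toℚ : ℤ → ℚ
toℚ z = z ℚ./ 1

sumℚ : List ℚ → ℚ
sumℚ = foldr ℚ._+_ 0ℚ

combo : ∀ {d} → List (Vec ℤ d × ℚ) → Vec ℚ d
combo []             = Vec.replicate _ 0ℚ
combo ((e , w) ∷ ws) = Vec.zipWith ℚ._+_ (Vec.map (λ z → w ℚ.* toℚ z) e) (combo ws)

InNewton : ∀ {d} → ℕ → Laurent d → Vec ℚ d → Set
InNewton {d} p Λ u =
  Σ (List (Vec ℤ d × ℚ)) λ ws →
    All (λ t → InSupp p Λ (proj₁ t) × (0ℚ ℚ.≤ proj₂ t)) ws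
    × (sumℚ (List.map proj₂ ws) ≡ 1ℚ)
    × (combo ws ≡ u)

InInterior : ∀ {d} → ℕ → Laurent d → Vec ℚ d → Set
InInterior {d} p Λ u =
  Σ ℚ λ ε → (0ℚ ℚ.< ε) ×
    (∀ (v : Vec ℚ d) → (∀ (i : Fin d) → ℚ.∣ Vec.lookup v i ℚ.- Vec.lookup u i ∣ ℚ.< ε)
       → InNewton p Λ v)

OriginOnlyInterior : ∀ {d} → ℕ → Laurent d → Set
OriginOnlyInterior {d} p Λ =
  InInterior p Λ (Vec.replicate d 0ℚ)
  × (∀ (u : Vec ℤ d) → InInterior p Λ (Vec.map toℚ u) → u ≡ Vec.replicate d (+ 0))

digitsAux : ℕ → ℕ → ℕ → List ℕ      -- base-2+m, with fuel
digitsAux m zero     n       = []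
digitsAux m (suc f)  zero    = []
digitsAux m (suc f) (suc n)  = (suc n % suc (suc m)) ∷ digitsAux m f (suc n / suc (suc m))

-- digits n_0, n_1, …, n_N (least significant first); 0 ↦ [0]
digits : ℕ → ℕ → List ℕ
digits zero          n       = n ∷ []        -- not used (p prime)
digits (suc zero)    n       = n ∷ []        -- not used (p prime)
digits (suc (suc m)) zero    = 0 ∷ []
digits (suc (suc m)) (suc n) = digitsAux m (suc n) (suc n)

InZeroSet : ℕ → (ℕ → Zp) → ℕ → Set
InZeroSet p A v = (v ℕ.< p) × InPowIdeal p 1 (A v)

data CountIn (P : ℕ → Set) : List ℕ → ℕ → Set where
  cnil : CountIn P [] 0
  cyes : ∀ {x xs c} → P x → CountIn P xs c → CountIn P (x ∷ xs) (suc c)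
  cno  : ∀ {x xs c} → ¬ P x → CountIn P xs c → CountIn P (x ∷ xs) c

AlphaIs : ℕ → (ℕ → Zp) → ℕ → ℕ → Set
AlphaIs p A n a = CountIn (InZeroSet p A) (digits p n) a

{-# OPTIONS --safe #-}

-- Modulo p^N the polynomial Λ may be replaced by a multiset M of exponents, and
-- M(x)^p = M(x^p) + p R(x) with R supported in pΔ. Expanding M^(v + pm) along this identity
-- and extracting p-th powers, the remaining constant terms are those of x^u M^(m-i) with a
-- factor p^i and u in (i + w)Δ, w < 1; for i = 0 the Newton polyhedron condition forces u = 0.
-- By induction on n = k + m, writing α(n) for the number of base-p digits of n at which A
-- vanishes mod p, p^k CT(x^u M^m) is divisible by p^α(n) for u in (k + w)Δ: when k ≥ 1 the
-- last digit of n costs at most one factor p, which the expansion supplies. When k = 0 the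
-- operator supplies it: modulo p^(a+1), a = α(m), the recurrence for A(v + pm), 0 ≤ v < p,
-- does not reach below pm, since there the squares in P_k outweigh the loss in α (type II: the
-- simple factor, together with the digit p - 1 of pm - 1), so A(v + pm) ≡ A(v) A(pm).
module Submission where

open import Defs
open import Data.Nat as ℕ using (ℕ; zero; suc; _+_; _*_; _^_; _∸_; _≤_; _<_; z≤n; s≤s; NonZero; _≤?_)
open import Data.Nat.Properties
open import Data.Nat.Combinatorics using (_C_; nCn≡1; nCk+nC[k+1]≡[n+1]C[k+1])
open import Data.Nat.Combinatorics.Specification using (k>n⇒nCk≡0)
open import Data.Nat.Coprimality using (Coprime; coprime-Bézout; coprime-divisor; coprime-factors)
open import Data.Nat.Divisibility
open import Data.Nat.DivMod using (_/_; _%_; m≡m%n+[m/n]*n; m%n<n)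
open import Data.Nat.GCD using (module Bézout)
open import Data.Nat.Induction using (<-rec)
open import Data.Nat.Primality using (Prime; euclidsLemma; prime⇒nonZero; prime⇒nonTrivial; prime⇒irreducible; ¬prime[0]; ¬prime[1])
open import Data.Nat.Tactic.RingSolver using (solve-∀)
open import Data.Integer as ℤ using (ℤ; +_)
import Data.Integer.Divisibility.Signed as ℤS
import Data.Integer.DivMod as ℤD
import Data.Integer.Properties as ℤₚ
import Data.Integer.Tactic.RingSolver as ℤR
open import Data.Rational as ℚ using (ℚ; 0ℚ; 1ℚ)
import Data.Rational.Properties as ℚₚ
import Data.Rational.Unnormalised as ℚᵘ
import Data.Rational.Unnormalised.Properties as ℚᵘₚ
open import Data.List as List using (List; []; _∷_; _++_; length)
import Data.List.Properties as Listₚ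
open import Data.List.Membership.Propositional using (_∈_)
open import Data.List.Membership.Propositional.Properties using (∈-map⁺; ∈-deduplicate⁺)
open import Data.List.Relation.Unary.All as All using (All; []; _∷_)
import Data.List.Relation.Unary.All.Properties as Allₚ
open import Data.List.Relation.Unary.AllPairs using (_∷_)
open import Data.List.Relation.Unary.Any using (here; there)
open import Data.List.Relation.Unary.Unique.DecPropositional.Properties using (deduplicate-!)
open import Data.List.Relation.Unary.Unique.Propositional using (Unique)
open import Data.Vec as Vec using (Vec; []; _∷_)
import Data.Vec.Properties as Vecₚ
open import Data.Product using (∃; ∃₂; _×_; _,_; proj₁; proj₂)
open import Data.Sum using (_⊎_; inj₁; inj₂)
open import Data.Bool using (if_then_else_; true; false)
open import Data.Empty using (⊥-elim)
open import Relation.Nullary using (¬_; Dec; yes; no; does)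
open import Relation.Nullary.Decidable using (dec-true; dec-false)
open import Relation.Binary.PropositionalEquality

-- Divisibility of `A n` alone does not reproduce itself: expanding M^(v + pm) leaves coefficients
-- at nonzero exponents of lower powers. The factor p^k is the price that makes the claim stable. If
-- u lies in (k + w)Δ and k + s = v + pj, then after s further factors of M, i factors R and
-- division of exponents by p, the new exponent lies in less than (j + i + 1)Δ, because w < 1 and v
-- + 1 ≤ p; the i factors p that came with R pay for the growth from j to j + i. All bounds stay
-- strict, so weight 0 always means a lattice point of wΔ with w < 1, hence an interior point of Δ,
-- hence the origin. A counted digit is never 0, as A(0) = 1; this is what leaves a factor p to
-- spare when k ≥ 1. For k = 0 nothing is left to spend, and only there does the differential
-- equation enter. Working modulo p^N turns Λ into a finite multiset, so the expansion is an
-- identity of natural numbers. The multiset depends on N, whence the bound a ≤ N throughout the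
-- induction.

private
  variable
    d : ℕ

-- Exponent vectors

infixl 6 _+ᵥ_
infixr 7 _·_

_+ᵥ_ : Vec ℤ d → Vec ℤ d → Vec ℤ d
_+ᵥ_ = Vec.zipWith ℤ._+_

0ᵥ : Vec ℤ d
0ᵥ = Vec.replicate _ (+ 0)

_·_ : ℕ → Vec ℤ d → Vec ℤ d
c · u = Vec.map (+ c ℤ.*_) u

+ᵥ-assoc : (u v w : Vec ℤ d) → (u +ᵥ v) +ᵥ w ≡ u +ᵥ (v +ᵥ w)
+ᵥ-assoc []      []      []      = refl
+ᵥ-assoc (x ∷ u) (y ∷ v) (z ∷ w) = cong₂ _∷_ (ℤₚ.+-assoc x y z) (+ᵥ-assoc u v w)

+ᵥ-comm : (u v : Vec ℤ d) → u +ᵥ v ≡ v +ᵥ u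
+ᵥ-comm []      []      = refl
+ᵥ-comm (x ∷ u) (y ∷ v) = cong₂ _∷_ (ℤₚ.+-comm x y) (+ᵥ-comm u v)

+ᵥ-identityʳ : (u : Vec ℤ d) → u +ᵥ 0ᵥ ≡ u
+ᵥ-identityʳ []      = refl
+ᵥ-identityʳ (x ∷ u) = cong₂ _∷_ (ℤₚ.+-identityʳ x) (+ᵥ-identityʳ u)

+ᵥ-identityˡ : (u : Vec ℤ d) → 0ᵥ +ᵥ u ≡ u
+ᵥ-identityˡ u = trans (+ᵥ-comm 0ᵥ u) (+ᵥ-identityʳ u)

+ᵥ-swapʳ : (u v w : Vec ℤ d) → (u +ᵥ v) +ᵥ w ≡ (u +ᵥ w) +ᵥ v
+ᵥ-swapʳ u v w = trans (+ᵥ-assoc u v w) (trans (cong (u +ᵥ_) (+ᵥ-comm v w)) (sym (+ᵥ-assoc u w v)))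

·-distribˡ : ∀ c (u v : Vec ℤ d) → c · (u +ᵥ v) ≡ c · u +ᵥ c · v
·-distribˡ c []      []      = refl
·-distribˡ c (x ∷ u) (y ∷ v) = cong₂ _∷_ (ℤₚ.*-distribˡ-+ (+ c) x y) (·-distribˡ c u v)

·-distribʳ : ∀ b c (u : Vec ℤ d) → (b + c) · u ≡ b · u +ᵥ c · u
·-distribʳ b c []      = refl
·-distribʳ b c (x ∷ u) = cong₂ _∷_ (ℤₚ.*-distribʳ-+ x (+ b) (+ c)) (·-distribʳ b c u)

·-assoc : ∀ b c (u : Vec ℤ d) → (b * c) · u ≡ b · (c · u)
·-assoc b c []      = refl
·-assoc b c (x ∷ u) = cong₂ _∷_ (trans (cong (ℤ._* x) (ℤₚ.pos-* b c)) (ℤₚ.*-assoc (+ b) (+ c) x)) (·-assoc b c u)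

·-identityˡ : (u : Vec ℤ d) → 1 · u ≡ u
·-identityˡ []      = refl
·-identityˡ (x ∷ u) = cong₂ _∷_ (ℤₚ.*-identityˡ x) (·-identityˡ u)

·-zeroˡ : (u : Vec ℤ d) → 0 · u ≡ 0ᵥ
·-zeroˡ []      = refl
·-zeroˡ (x ∷ u) = cong (+ 0 ∷_) (·-zeroˡ u)

·-zeroʳ : ∀ c → c · 0ᵥ {d} ≡ 0ᵥ
·-zeroʳ {zero}  c = refl
·-zeroʳ {suc d} c = cong₂ _∷_ (ℤₚ.*-zeroʳ (+ c)) (·-zeroʳ c)

·-suc : ∀ c (u : Vec ℤ d) → suc c · u ≡ u +ᵥ c · u
·-suc c u = trans (·-distribʳ 1 c u) (cong (_+ᵥ c · u) (·-identityˡ u))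

·-cancelˡ : ∀ c .{{_ : NonZero c}} {u v : Vec ℤ d} → c · u ≡ c · v → u ≡ v
·-cancelˡ c         {[]}    {[]}    _  = refl
·-cancelˡ c@(suc _) {x ∷ u} {y ∷ v} eq =
  cong₂ _∷_ (ℤₚ.*-cancelˡ-≡ (+ c) x y (cong Vec.head eq)) (·-cancelˡ c (cong Vec.tail eq))

_≟ᵥ_ : (u v : Vec ℤ d) → Dec (u ≡ v)
_≟ᵥ_ = Vecₚ.≡-dec ℤ._≟_

MultipleOf : ℕ → Vec ℤ d → Set
MultipleOf c u = ∃ λ v → u ≡ c · v

multipleOf? : ∀ c (u : Vec ℤ d) → Dec (MultipleOf c u)
multipleOf? c []      = yes ([] , refl)
multipleOf? c (x ∷ u) with + c ℤS.∣? x | multipleOf? c u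
... | yes (ℤS.divides q eq) | yes (v , eq′) = yes (q ∷ v , cong₂ _∷_ (trans eq (ℤₚ.*-comm q (+ c))) eq′)
... | no ∤x | _      = no λ { (y ∷ v , eq) → ∤x (ℤS.divides y (trans (cong Vec.head eq) (ℤₚ.*-comm (+ c) y))) }
... | _     | no ∤u  = no λ { (y ∷ v , eq) → ∤u (v , cong Vec.tail eq) }

multipleOf-cancelʳ : ∀ c {u v : Vec ℤ d} → MultipleOf c (u +ᵥ c · v) → MultipleOf c u
multipleOf-cancelʳ c {[]}    {[]}    _            = [] , refl
multipleOf-cancelʳ c {x ∷ u} {y ∷ v} (z ∷ w , eq)
  with multipleOf-cancelʳ c {u} {v} (w , cong Vec.tail eq)
... | w′ , eq′ = z ℤ.- y ∷ w′ , cong₂ _∷_ lemma eq′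
  where
  open ≡-Reasoning
  lemma : x ≡ + c ℤ.* (z ℤ.- y)
  lemma = begin
    x                                              ≡⟨ ℤₚ.+-identityʳ x ⟨
    x ℤ.+ + 0                                      ≡⟨ cong (λ t → x ℤ.+ t) (ℤₚ.+-inverseʳ (+ c ℤ.* y)) ⟨
    x ℤ.+ (+ c ℤ.* y ℤ.- + c ℤ.* y)                ≡⟨ ℤₚ.+-assoc x _ _ ⟨
    (x ℤ.+ + c ℤ.* y) ℤ.- + c ℤ.* y                ≡⟨ cong (ℤ._- (+ c ℤ.* y)) (cong Vec.head eq) ⟩
    + c ℤ.* z ℤ.- + c ℤ.* y                        ≡⟨ cong (λ t → + c ℤ.* z ℤ.+ t) (ℤₚ.neg-distribʳ-* (+ c) y) ⟩
    + c ℤ.* z ℤ.+ + c ℤ.* (ℤ.- y)                  ≡⟨ ℤₚ.*-distribˡ-+ (+ c) z (ℤ.- y) ⟨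
    + c ℤ.* (z ℤ.- y)                              ∎

-- Multisets of exponents acting on functions

δ : Vec ℤ d → ℕ
δ u = if does (u ≟ᵥ 0ᵥ) then 1 else 0

-- A list M of exponents is the Laurent polynomial Σ x^e; it acts on functions
-- of exponents by correlation, so that pow M n δ 0ᵥ is the constant term of M^n.
act : List (Vec ℤ d) → (Vec ℤ d → ℕ) → Vec ℤ d → ℕ
act []      φ u = 0
act (e ∷ M) φ u = φ (u +ᵥ e) + act M φ u

pow : List (Vec ℤ d) → ℕ → (Vec ℤ d → ℕ) → Vec ℤ d → ℕ
pow M zero    φ = φ
pow M (suc n) φ = pow M n (act M φ)

act-cong : ∀ (M : List (Vec ℤ d)) {φ ψ} → (∀ u → φ u ≡ ψ u) → ∀ u → act M φ u ≡ act M ψ u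
act-cong []      eq u = refl
act-cong (e ∷ M) eq u = cong₂ _+_ (eq (u +ᵥ e)) (act-cong M eq u)

pow-cong : ∀ (M : List (Vec ℤ d)) n {φ ψ} → (∀ u → φ u ≡ ψ u) → ∀ u → pow M n φ u ≡ pow M n ψ u
pow-cong M zero    eq = eq
pow-cong M (suc n) eq = pow-cong M n (act-cong M eq)

act-+ : ∀ (M : List (Vec ℤ d)) φ ψ u → act M (λ x → φ x + ψ x) u ≡ act M φ u + act M ψ u
act-+ []      φ ψ u = refl
act-+ (e ∷ M) φ ψ u rewrite act-+ M φ ψ u = interchange (φ (u +ᵥ e)) (ψ (u +ᵥ e)) (act M φ u) (act M ψ u)
  where
  interchange : ∀ a b c d → a + b + (c + d) ≡ a + c + (b + d)
  interchange = solve-∀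

pow-+ : ∀ (M : List (Vec ℤ d)) n φ ψ u → pow M n (λ x → φ x + ψ x) u ≡ pow M n φ u + pow M n ψ u
pow-+ M zero    φ ψ u = refl
pow-+ M (suc n) φ ψ u = trans (pow-cong M n (act-+ M φ ψ) u) (pow-+ M n (act M φ) (act M ψ) u)

act-zero : ∀ (M : List (Vec ℤ d)) u → act M (λ _ → 0) u ≡ 0
act-zero []      u = refl
act-zero (e ∷ M) u = act-zero M u

act-shift : ∀ (M : List (Vec ℤ d)) φ w u → act M (λ x → φ (x +ᵥ w)) u ≡ act M φ (u +ᵥ w)
act-shift []      φ w u = refl
act-shift (e ∷ M) φ w u = cong₂ _+_ (cong φ (+ᵥ-swapʳ u e w)) (act-shift M φ w u)

pow-shift : ∀ (M : List (Vec ℤ d)) n φ w u → pow M n (λ x → φ (x +ᵥ w)) u ≡ pow M n φ (u +ᵥ w)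
pow-shift M zero    φ w u = refl
pow-shift M (suc n) φ w u = trans (pow-cong M n (act-shift M φ w) u) (pow-shift M n (act M φ) w u)

act-comm : ∀ (M M′ : List (Vec ℤ d)) φ u → act M (act M′ φ) u ≡ act M′ (act M φ) u
act-comm []      M′ φ u = sym (act-zero M′ u)
act-comm (e ∷ M) M′ φ u = begin
  act M′ φ (u +ᵥ e) + act M (act M′ φ) u                ≡⟨ cong₂ _+_ (sym (act-shift M′ φ e u)) (act-comm M M′ φ u) ⟩
  act M′ (λ x → φ (x +ᵥ e)) u + act M′ (act M φ) u      ≡⟨ act-+ M′ _ _ u ⟨
  act M′ (act (e ∷ M) φ) u                              ∎
  where open ≡-Reasoning

pow-act : ∀ (M M′ : List (Vec ℤ d)) n φ u → pow M n (act M′ φ) u ≡ act M′ (pow M n φ) u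
pow-act M M′ zero    φ u = refl
pow-act M M′ (suc n) φ u = trans (pow-cong M n (act-comm M M′ φ) u) (pow-act M M′ n (act M φ) u)

pow-add : ∀ (M : List (Vec ℤ d)) m n φ u → pow M (m + n) φ u ≡ pow M m (pow M n φ) u
pow-add M zero    n φ u = refl
pow-add M (suc m) n φ u =
  trans (pow-add M m n (act M φ) u) (pow-cong M m (pow-act M M n φ) u)

-- Binomial sums

sumTo : ℕ → (ℕ → ℕ) → ℕ
sumTo zero    h = 0
sumTo (suc n) h = h 0 + sumTo n (λ i → h (suc i))

sumTo-cong : ∀ n {h h′ : ℕ → ℕ} → (∀ i → i < n → h i ≡ h′ i) → sumTo n h ≡ sumTo n h′
sumTo-cong zero    eq = refl
sumTo-cong (suc n) eq = cong₂ _+_ (eq 0 (s≤s z≤n)) (sumTo-cong n (λ i i<n → eq (suc i) (s≤s i<n)))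

sumTo-+ : ∀ n (h h′ : ℕ → ℕ) → sumTo n (λ i → h i + h′ i) ≡ sumTo n h + sumTo n h′
sumTo-+ zero    h h′ = refl
sumTo-+ (suc n) h h′ rewrite sumTo-+ n (λ i → h (suc i)) (λ i → h′ (suc i)) =
  interchange (h 0) (h′ 0) (sumTo n (λ i → h (suc i))) (sumTo n (λ i → h′ (suc i)))
  where
  interchange : ∀ a b c d → a + b + (c + d) ≡ a + c + (b + d)
  interchange = solve-∀

sumTo-last : ∀ n (h : ℕ → ℕ) → sumTo (suc n) h ≡ sumTo n h + h n
sumTo-last zero    h = +-comm (h 0) 0
sumTo-last (suc n) h = trans (cong (λ t → h 0 + t) (sumTo-last n (λ i → h (suc i)))) (sym (+-assoc (h 0) _ _))

binomialSum : ℕ → (ℕ → ℕ → ℕ) → ℕ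
binomialSum n g = sumTo (suc n) (λ i → (n C i) * g i (n ∸ i))

-- Pascal's rule summed over i.
binomialSum-suc : ∀ n g → binomialSum (suc n) g ≡
  binomialSum n (λ i l → g (suc i) l) + binomialSum n (λ i l → g i (suc l))
binomialSum-suc n g = begin
  1 * g 0 (suc n) + sumTo (suc n) (λ i → (suc n C suc i) * g (suc i) (n ∸ i))
    ≡⟨ cong (λ t → 1 * g 0 (suc n) + t) (trans (sumTo-cong (suc n) split) (sumTo-+ (suc n) (λ i → (n C i) * g (suc i) (n ∸ i)) h)) ⟩
  1 * g 0 (suc n) + (binomialSum n (λ i l → g (suc i) l) + sumTo (suc n) h)
    ≡⟨ rearrange (1 * g 0 (suc n)) (binomialSum n (λ i l → g (suc i) l)) (sumTo (suc n) h) ⟩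
  binomialSum n (λ i l → g (suc i) l) + (1 * g 0 (suc n) + sumTo (suc n) h)
    ≡⟨ cong (λ z → binomialSum n (λ i l → g (suc i) l) + (1 * g 0 (suc n) + z)) dropLast ⟩
  binomialSum n (λ i l → g (suc i) l) + (1 * g 0 (suc n) + sumTo n h)
    ≡⟨ cong (λ z → binomialSum n (λ i l → g (suc i) l) + (1 * g 0 (suc n) + z)) (sumTo-cong n shift) ⟩
  binomialSum n (λ i l → g (suc i) l) + binomialSum n (λ i l → g i (suc l)) ∎
  where
  open ≡-Reasoning
  h : ℕ → ℕ
  h i = (n C suc i) * g (suc i) (n ∸ i)
  split : ∀ i → i < suc n →
    (suc n C suc i) * g (suc i) (n ∸ i) ≡ (n C i) * g (suc i) (n ∸ i) + h i
  split i _ = trans (cong (_* g (suc i) (n ∸ i)) (sym (nCk+nC[k+1]≡[n+1]C[k+1] n i)))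
                    (*-distribʳ-+ (g (suc i) (n ∸ i)) (n C i) (n C suc i))
  rearrange : ∀ a b c → a + (b + c) ≡ b + (a + c)
  rearrange = solve-∀
  -- The summand i = n has coefficient n C (n + 1) = 0. It must go before `shift`, which rewrites a
  -- truncated subtraction and is valid only for i < n.
  dropLast : sumTo (suc n) h ≡ sumTo n h
  dropLast = trans (sumTo-last n h)
    (trans (cong (λ z → sumTo n h + z * g (suc n) (n ∸ n)) (k>n⇒nCk≡0 (n<1+n n))) (+-identityʳ _))
  shift : ∀ i → i < n → h i ≡ (n C suc i) * g (suc i) (suc (n ∸ suc i))
  shift i i<n = cong (λ z → (n C suc i) * g (suc i) z) (sym (m∸n≡suc i<n))
    where
    m∸n≡suc : ∀ {n i} → i < n → suc (n ∸ suc i) ≡ n ∸ i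
    m∸n≡suc {suc n} {zero}  _         = refl
    m∸n≡suc {suc n} {suc i} (s≤s i<n) = m∸n≡suc i<n

-- The binomial theorem for (x^e + M)^n, with i counting the factors x^e.
pow-∷ : ∀ (e : Vec ℤ d) M n φ u → pow (e ∷ M) n φ u ≡ binomialSum n (λ i l → pow M l φ (u +ᵥ i · e))
pow-∷ e M zero    φ u = begin
  φ u                      ≡⟨ cong φ (trans (cong (u +ᵥ_) (·-zeroˡ e)) (+ᵥ-identityʳ u)) ⟨
  φ (u +ᵥ 0 · e)           ≡⟨ +-identityʳ _ ⟨
  φ (u +ᵥ 0 · e) + 0       ≡⟨ +-identityʳ _ ⟨
  φ (u +ᵥ 0 · e) + 0 + 0   ∎
  where open ≡-Reasoning
pow-∷ e M (suc n) φ u = begin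
  pow (e ∷ M) n (λ x → φ (x +ᵥ e) + act M φ x) u
    ≡⟨ pow-+ (e ∷ M) n _ _ u ⟩
  pow (e ∷ M) n (λ x → φ (x +ᵥ e)) u + pow (e ∷ M) n (act M φ) u
    ≡⟨ cong₂ _+_ (pow-∷ e M n _ u) (pow-∷ e M n _ u) ⟩
  binomialSum n (λ i l → pow M l (λ x → φ (x +ᵥ e)) (u +ᵥ i · e)) + binomialSum n (λ i l → g i (suc l))
    ≡⟨ cong (_+ binomialSum n (λ i l → g i (suc l)))
         (sumTo-cong (suc n) (λ i _ → cong ((n C i) *_) (step i (n ∸ i)))) ⟩
  binomialSum n (λ i l → g (suc i) l) + binomialSum n (λ i l → g i (suc l))
    ≡⟨ binomialSum-suc n g ⟨
  binomialSum (suc n) g ∎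
  where
  open ≡-Reasoning
  g : ℕ → ℕ → ℕ
  g i l = pow M l φ (u +ᵥ i · e)
  step : ∀ i l → pow M l (λ x → φ (x +ᵥ e)) (u +ᵥ i · e) ≡ g (suc i) l
  step i l = trans (pow-shift M l φ e _) (cong (pow M l φ)
    (trans (+ᵥ-assoc u _ e) (cong (u +ᵥ_) (trans (+ᵥ-comm (i · e) e) (sym (·-suc i e))))))

-- For n + 1 = p the right side is a multiple of p, so p divides the binomial coefficient as soon as
-- it does not divide k + 1.
absorption : ∀ n k → suc k * (suc n C suc k) ≡ suc n * (n C k)
absorption zero    zero    = refl
absorption zero    (suc k)
  rewrite k>n⇒nCk≡0 {1} {suc (suc k)} (s≤s (s≤s z≤n)) | k>n⇒nCk≡0 {0} {suc k} (s≤s z≤n) = *-zeroʳ (suc (suc k))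
absorption (suc n) zero    = begin
  1 * (suc (suc n) C 1)                 ≡⟨ cong (1 *_) (nCk+nC[k+1]≡[n+1]C[k+1] (suc n) 0) ⟨
  1 * (1 + (suc n C 1))                 ≡⟨ rearrange (suc n C 1) ⟩
  1 + 1 * (suc n C 1)                   ≡⟨ cong suc (absorption n 0) ⟩
  1 + suc n * 1                         ≡⟨⟩
  suc (suc n) * 1                       ∎
  where
  open ≡-Reasoning
  rearrange : ∀ x → 1 * (1 + x) ≡ 1 + 1 * x
  rearrange = solve-∀
absorption (suc n) (suc k) = begin
  suc (suc k) * (suc (suc n) C suc (suc k))
    ≡⟨ cong (suc (suc k) *_) (nCk+nC[k+1]≡[n+1]C[k+1] (suc n) (suc k)) ⟨
  suc (suc k) * ((suc n C suc k) + (suc n C suc (suc k)))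
    ≡⟨ expand k (suc n C suc k) (suc n C suc (suc k)) ⟩
  (suc n C suc k) + (suc k * (suc n C suc k) + suc (suc k) * (suc n C suc (suc k)))
    ≡⟨ cong₂ (λ x y → (suc n C suc k) + (x + y)) (absorption n k) (absorption n (suc k)) ⟩
  (suc n C suc k) + (suc n * (n C k) + suc n * (n C suc k))
    ≡⟨ cong (λ t → (suc n C suc k) + t) (*-distribˡ-+ (suc n) (n C k) (n C suc k)) ⟨
  (suc n C suc k) + suc n * ((n C k) + (n C suc k))
    ≡⟨ cong (λ z → (suc n C suc k) + suc n * z) (nCk+nC[k+1]≡[n+1]C[k+1] n k) ⟩
  suc (suc n) * (suc n C suc k) ∎
  where
  open ≡-Reasoning
  expand : ∀ k x y → suc (suc k) * (x + y) ≡ x + (suc k * x + suc (suc k) * y)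
  expand = solve-∀

prime∣binomial : ∀ {p} → Prime p → ∀ k → suc k < p → p ∣ (p C suc k)
prime∣binomial {suc n} pr k k<p
  with euclidsLemma (suc k) (suc n C suc k) pr (divides (n C k) (trans (absorption n k) (*-comm (suc n) (n C k))))
... | inj₁ p∣k = ⊥-elim (<⇒≱ k<p (∣⇒≤ p∣k))
... | inj₂ p∣C = p∣C

∣-*0 : ∀ {X} y → X ∣ y * 0
∣-*0 {X} y = subst (X ∣_) (sym (*-zeroʳ y)) (X ∣0)

-- The cofactor r is a combination of the values of f. The last component records exactly the
-- consequence needed later, that r inherits every divisibility shared by these values, so the
-- combination itself can be forgotten. The multiplier y is where powers of p are accumulated.
sumTo-factor : ∀ {p} n (c f : ℕ → ℕ) → (∀ i → i < n → p ∣ c i) →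
  ∃ λ r → sumTo n (λ i → c i * f i) ≡ p * r × (∀ {X} y → (∀ i → i < n → X ∣ y * f i) → X ∣ y * r)
sumTo-factor {p} zero c f p∣c = 0 , sym (*-zeroʳ p) , λ y _ → ∣-*0 y
sumTo-factor {p} (suc n) c f p∣c
  with p∣c 0 (s≤s z≤n) | sumTo-factor n (λ i → c (suc i)) (λ i → f (suc i)) (λ i i<n → p∣c (suc i) (s≤s i<n))
... | divides q eq | r , eq′ , comb = q * f 0 + r , value , λ {X} y X∣f →
      subst (X ∣_) (sym (*-distribˡ-+ y (q * f 0) r))
        (∣m∣n⇒∣m+n (subst (X ∣_) (swap q y (f 0)) (∣n⇒∣m*n q (X∣f 0 (s≤s z≤n))))
                   (comb y (λ i i<n → X∣f (suc i) (s≤s i<n))))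
  where
  swap : ∀ q y x → q * (y * x) ≡ y * (q * x)
  swap = solve-∀
  factor : ∀ q p x r → q * p * x + p * r ≡ p * (q * x + r)
  factor = solve-∀
  value : c 0 * f 0 + sumTo n (λ i → c (suc i) * f (suc i)) ≡ p * (q * f 0 + r)
  value = trans (cong₂ (λ a b → a * f 0 + b) eq eq′) (factor q p (f 0) r)

-- The Frobenius congruence with control of the support

data SumOf (S : Vec ℤ d → Set) : ℕ → Vec ℤ d → Set where
  nil  : SumOf S 0 0ᵥ
  cons : ∀ {e n w} → S e → SumOf S n w → SumOf S (suc n) (e +ᵥ w)

module _ {S : Vec ℤ d → Set} where

  SumOf-+ : ∀ {m n v w} → SumOf S m v → SumOf S n w → SumOf S (m + n) (v +ᵥ w)
  SumOf-+ {w = w} nil s = subst (SumOf S _) (sym (+ᵥ-identityˡ w)) s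
  SumOf-+ (cons {e} {w = v} Se s) s′ = subst (SumOf S _) (sym (+ᵥ-assoc e v _)) (cons Se (SumOf-+ s s′))

  SumOf-· : ∀ c {n w} → SumOf S n w → SumOf S (c * n) (c · w)
  SumOf-· zero    {w = w} s = subst (SumOf S 0) (sym (·-zeroˡ w)) nil
  SumOf-· (suc c) {w = w} s = subst (SumOf S _) (sym (·-suc c w)) (SumOf-+ s (SumOf-· c s))

  SumOf-1 : ∀ {e} → S e → SumOf S 1 e
  SumOf-1 {e} Se = subst (SumOf S 1) (+ᵥ-identityʳ e) (cons Se nil)

  act-∣ : ∀ {M X} y {φ u} → All S M → (∀ e → S e → X ∣ y * φ (u +ᵥ e)) → X ∣ y * act M φ u
  act-∣ y []        X∣ = ∣-*0 y
  act-∣ {X = X} y (Se ∷ SM) X∣ =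
    subst (X ∣_) (sym (*-distribˡ-+ y _ _)) (∣m∣n⇒∣m+n (X∣ _ Se) (act-∣ y SM X∣))

  -- Expanding M^n only reaches exponents u + w with w a sum of n members of S, so divisibility at
  -- these exponents suffices.
  pow-∣ : ∀ {M X} y n {φ u} → All S M → (∀ w → SumOf S n w → X ∣ y * φ (u +ᵥ w)) → X ∣ y * pow M n φ u
  pow-∣ {M} {X} y zero    {φ} {u} SM X∣ = subst (λ z → X ∣ y * φ z) (+ᵥ-identityʳ u) (X∣ 0ᵥ nil)
  pow-∣ {M} {X} y (suc n) {φ} {u} SM X∣ = pow-∣ y n SM λ w s → act-∣ y SM λ e Se →
    subst (λ z → X ∣ y * φ z) (trans (cong (u +ᵥ_) (+ᵥ-comm e w)) (sym (+ᵥ-assoc u w e))) (X∣ (e +ᵥ w) (cons Se s))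

  -- M(x)^p = M(x^p) + p R(x), where R is supported on sums of p exponents of M.
  freshman : ∀ {p M} → Prime p → All S M → ∀ φ u →
    ∃ λ r → pow M p φ u ≡ act (List.map (p ·_) M) φ u + p * r
          × (∀ {X} y → (∀ w → SumOf S p w → X ∣ y * φ (u +ᵥ w)) → X ∣ y * r)
  freshman {suc p} pr [] φ u = 0 , trans (vanish p) (sym (*-zeroʳ p)) , λ y _ → ∣-*0 y
    where
    vanish : ∀ n → pow [] n (λ _ → 0) u ≡ 0
    vanish zero    = refl
    vanish (suc n) = vanish n
  freshman {p@(suc p′)} {e ∷ M} pr (Se ∷ SM) φ u
    with freshman pr SM φ u
       | sumTo-factor p′ (λ i → p C suc i) (λ i → pow M (p′ ∸ i) φ (u +ᵥ suc i · e))
           (λ i i<p′ → prime∣binomial pr i (s≤s i<p′))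
  ... | r , eq , comb | r′ , eq′ , comb′ = r + r′ , value , divisibility
    where
    g : ℕ → ℕ → ℕ
    g i l = pow M l φ (u +ᵥ i · e)
    value : pow (e ∷ M) p φ u ≡ φ (u +ᵥ p · e) + act (List.map (p ·_) M) φ u + p * (r + r′)
    value = begin
      pow (e ∷ M) p φ u
        ≡⟨ pow-∷ e M p φ u ⟩
      1 * g 0 p + sumTo (suc p′) (λ i → (p C suc i) * g (suc i) (p′ ∸ i))
        ≡⟨ cong (λ z → 1 * g 0 p + z) (sumTo-last p′ (λ i → (p C suc i) * g (suc i) (p′ ∸ i))) ⟩
      1 * g 0 p + (sumTo p′ (λ i → (p C suc i) * g (suc i) (p′ ∸ i)) + (p C p) * g p (p′ ∸ p′))
        ≡⟨ cong₂ (λ a b → 1 * g 0 p + (a + b)) eq′ (cong₂ _*_ (nCn≡1 p) (cong (g p) (n∸n≡0 p′))) ⟩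
      1 * g 0 p + (p * r′ + 1 * φ (u +ᵥ p · e))
        ≡⟨ cong (λ z → 1 * z + (p * r′ + 1 * φ (u +ᵥ p · e)))
             (trans (cong (pow M p φ) (trans (cong (u +ᵥ_) (·-zeroˡ e)) (+ᵥ-identityʳ u))) eq) ⟩
      1 * (act (List.map (p ·_) M) φ u + p * r) + (p * r′ + 1 * φ (u +ᵥ p · e))
        ≡⟨ rearrange (act (List.map (p ·_) M) φ u) p r r′ (φ (u +ᵥ p · e)) ⟩
      φ (u +ᵥ p · e) + act (List.map (p ·_) M) φ u + p * (r + r′) ∎
      where
      open ≡-Reasoning
      rearrange : ∀ a p r r′ b → 1 * (a + p * r) + (p * r′ + 1 * b) ≡ b + a + p * (r + r′)
      rearrange = solve-∀
    divisibility : ∀ {X} y → (∀ w → SumOf S p w → X ∣ y * φ (u +ᵥ w)) → X ∣ y * (r + r′)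
    divisibility {X} y X∣ = subst (X ∣_) (sym (*-distribˡ-+ y r r′)) (∣m∣n⇒∣m+n (comb y X∣)
      (comb′ y λ i i<p′ → pow-∣ y (p′ ∸ i) SM λ w s →
        subst (λ z → X ∣ y * φ z) (sym (+ᵥ-assoc u (suc i · e) w))
          (X∣ (suc i · e +ᵥ w) (subst (λ z → SumOf S z (suc i · e +ᵥ w)) (total i i<p′)
            (SumOf-+ (SumOf-· (suc i) (SumOf-1 Se)) s)))))
      where
      total : ∀ i → i < p′ → suc i * 1 + (p′ ∸ i) ≡ p
      total i i<p′ = trans (cong (_+ (p′ ∸ i)) (*-identityʳ (suc i))) (cong suc (m+[n∸m]≡n (<⇒≤ i<p′)))

-- Extraction of p-th powers and the expansion of M^(s + tp)

module _ (p : ℕ) .{{_ : NonZero p}} where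

  -- Together with `pow-dilate-vanish`: x^u M(x^p)^t has constant term 0 unless p divides u, and
  -- then it has the constant term of x^(u/p) M^t.
  pow-dilate : ∀ (M : List (Vec ℤ d)) t {φ ψ} → (∀ u → φ (p · u) ≡ ψ u) →
    ∀ u → pow (List.map (p ·_) M) t φ (p · u) ≡ pow M t ψ u
  pow-dilate M zero    eq = eq
  pow-dilate M (suc t) eq = pow-dilate M t (act-dilate M eq)
    where
    act-dilate : ∀ (M : List (Vec ℤ d)) {φ ψ} → (∀ u → φ (p · u) ≡ ψ u) →
      ∀ u → act (List.map (p ·_) M) φ (p · u) ≡ act M ψ u
    act-dilate []      eq u = refl
    act-dilate (e ∷ M) {φ} eq u =
      cong₂ _+_ (trans (cong φ (sym (·-distribˡ p u e))) (eq (u +ᵥ e))) (act-dilate M eq u)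

  pow-dilate-vanish : ∀ (M : List (Vec ℤ d)) t {φ} → (∀ u → ¬ MultipleOf p u → φ u ≡ 0) →
    ∀ u → ¬ MultipleOf p u → pow (List.map (p ·_) M) t φ u ≡ 0
  pow-dilate-vanish M zero    φ≡0 = φ≡0
  pow-dilate-vanish M (suc t) φ≡0 = pow-dilate-vanish M t (vanish M φ≡0)
    where
    vanish : ∀ (M : List (Vec ℤ d)) {φ} → (∀ u → ¬ MultipleOf p u → φ u ≡ 0) →
      ∀ u → ¬ MultipleOf p u → act (List.map (p ·_) M) φ u ≡ 0
    vanish []      φ≡0 u ∤u = refl
    vanish (e ∷ M) φ≡0 u ∤u = cong₂ _+_ (φ≡0 _ (λ m → ∤u (multipleOf-cancelʳ p {v = e} m))) (vanish M φ≡0 u ∤u)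

  δ-dilate : (u : Vec ℤ d) → δ (p · u) ≡ δ u
  δ-dilate u with (p · u) ≟ᵥ 0ᵥ | u ≟ᵥ 0ᵥ
  ... | yes _  | yes _  = refl
  ... | no _   | no _   = refl
  ... | yes eq | no ¬eq = ⊥-elim (¬eq (·-cancelˡ p (trans eq (sym (·-zeroʳ p)))))
  ... | no ¬eq | yes eq = ⊥-elim (¬eq (trans (cong (p ·_) eq) (·-zeroʳ p)))

  δ-vanish : (u : Vec ℤ d) → ¬ MultipleOf p u → δ u ≡ 0
  δ-vanish u ∤u with u ≟ᵥ 0ᵥ
  ... | yes eq = ⊥-elim (∤u (0ᵥ , trans eq (sym (·-zeroʳ p))))
  ... | no _   = refl

-- u lies in w Δ for some rational 0 ≤ w < k + 1, where Δ is the convex hull of S.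
Below : (Vec ℤ d → Set) → ℕ → Vec ℤ d → Set
Below S k u = ∃₂ λ c r → r < suc k * c × SumOf S r (c · u)

module Expansion {p : ℕ} (pr : Prime p) {S : Vec ℤ d → Set} {M : List (Vec ℤ d)} (SM : All S M) where

  private instance
    p≢0 : NonZero p
    p≢0 = prime⇒nonZero pr

  Mᵖ : List (Vec ℤ d)
  Mᵖ = List.map (p ·_) M

  SumOf-shift : ∀ c {r u q w} → SumOf S r (c · u) → SumOf S q w → SumOf S (r + c * q) (c · (u +ᵥ w))
  SumOf-shift c {u = u} {w = w} s s′ = subst (SumOf S _) (sym (·-distribˡ c u w)) (SumOf-+ s (SumOf-· c s′))

  -- One factor M^p at a time is replaced by M(x^p) + p R; t counts the factors
  -- M^p still to be treated, t′ the factors M(x^p) and i the factors p R produced.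
  expand : ∀ {c r₀ T Q W} →
    (∀ i t′ u → i + t′ ≡ T → SumOf S (r₀ + c * (i * p)) (c · (p · u)) → Q ∣ W * (p ^ i * pow M t′ δ u)) →
    ∀ t i t′ u → i + (t + t′) ≡ T → SumOf S (r₀ + c * (i * p)) (c · u) →
    Q ∣ W * (p ^ i * pow M (t * p) (pow Mᵖ t′ δ) u)
  expand {Q = Q} {W} hyp zero i t′ u eq s with multipleOf? p u
  ... | yes (v , refl) = subst (λ z → Q ∣ W * (p ^ i * z)) (sym (pow-dilate p M t′ (δ-dilate p) v)) (hyp i t′ v eq s)
  ... | no ∤u = subst (Q ∣_) (sym (trans (cong (λ z → W * (p ^ i * z)) (pow-dilate-vanish p M t′ (δ-vanish p) u ∤u))
                                         (trans (cong (W *_) (*-zeroʳ (p ^ i))) (*-zeroʳ W)))) (Q ∣0)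
  expand {c} {r₀} {T} {Q} {W} hyp (suc t) i t′ u eq s
    with freshman pr SM (pow M (t * p) (pow Mᵖ t′ δ)) u
  ... | r , eq′ , comb = subst (Q ∣_) (sym value) (∣m∣n⇒∣m+n first second)
    where
    ψ : Vec ℤ d → ℕ
    ψ = pow M (t * p) (pow Mᵖ t′ δ)
    value : W * (p ^ i * pow M (p + t * p) (pow Mᵖ t′ δ) u) ≡
            W * (p ^ i * pow M (t * p) (pow Mᵖ (suc t′) δ) u) + W * p ^ suc i * r
    value = begin
      W * (p ^ i * pow M (p + t * p) (pow Mᵖ t′ δ) u)
        ≡⟨ cong (λ z → W * (p ^ i * z)) (trans (pow-add M p (t * p) _ u) eq′) ⟩
      W * (p ^ i * (act Mᵖ ψ u + p * r))
        ≡⟨ cong (λ z → W * (p ^ i * (z + p * r))) (trans (sym (pow-act M Mᵖ (t * p) _ u))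
             (pow-cong M (t * p) (λ x → sym (pow-act Mᵖ Mᵖ t′ δ x)) u)) ⟩
      W * (p ^ i * (pow M (t * p) (pow Mᵖ (suc t′) δ) u + p * r))
        ≡⟨ distribute W (p ^ i) (pow M (t * p) (pow Mᵖ (suc t′) δ) u) p r ⟩
      W * (p ^ i * pow M (t * p) (pow Mᵖ (suc t′) δ) u) + W * p ^ suc i * r ∎
      where
      open ≡-Reasoning
      distribute : ∀ W q z p r → W * (q * (z + p * r)) ≡ W * (q * z) + W * (p * q) * r
      distribute = solve-∀
    first : Q ∣ W * (p ^ i * pow M (t * p) (pow Mᵖ (suc t′) δ) u)
    first = expand {c} {r₀} {T} {Q} {W} hyp t i (suc t′) u (trans (cong (λ z → i + z) (+-suc t t′)) eq) s
    second : Q ∣ W * p ^ suc i * r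
    second = comb (W * p ^ suc i) λ w s′ → subst (Q ∣_) (sym (*-assoc W (p ^ suc i) (ψ (u +ᵥ w))))
      (expand {c} {r₀} {T} {Q} {W} hyp t (suc i) t′ (u +ᵥ w) (trans (sym (+-suc i (t + t′))) eq)
        (subst (λ z → SumOf S z (c · (u +ᵥ w))) (regroup r₀ c i p) (SumOf-shift c s s′)))
      where
      regroup : ∀ r₀ c i p → r₀ + c * (i * p) + c * p ≡ r₀ + c * (suc i * p)
      regroup = solve-∀

  -- The s factors outside complete p-th powers are multiplied out first; the t factors M^p then go
  -- through `expand`. Dividing exponents by p is encoded by enlarging the denominator c to c p, and
  -- v < p absorbs the strict inequality r < (k + 1)c into the bound for weight j + i.
  expansion : ∀ {Q W j v} t s k u → v < p → k + s ≡ v + p * j → Below S k u →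
    (∀ i t′ u′ → i + t′ ≡ t → Below S (j + i) u′ → Q ∣ W * (p ^ i * pow M t′ δ u′)) →
    Q ∣ W * pow M (s + t * p) δ u
  expansion {Q} {W} {j} {v} t s k u v<p k+s (c , r , r<kc , sum) hyp =
    subst (λ z → Q ∣ W * z) (sym (pow-add M s (t * p) δ u))
      (pow-∣ W s SM λ w sw →
        subst (λ z → Q ∣ W * z) (*-identityˡ (pow M (t * p) δ (u +ᵥ w)))
        (expand {c} {r + c * s} {t} {Q} {W} hyp′ t 0 0 (u +ᵥ w) (+-identityʳ t)
          (subst (λ z → SumOf S z (c · (u +ᵥ w))) (pad (r + c * s) c) (SumOf-shift c sum sw))))
    where
    pad : ∀ x c → x ≡ x + c * 0
    pad = solve-∀
    hyp′ : ∀ i t′ u → i + t′ ≡ t → SumOf S (r + c * s + c * (i * p)) (c · (p · u)) → Q ∣ W * (p ^ i * pow M t′ δ u)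
    hyp′ i t′ u′ eq sum′ = hyp i t′ u′ eq
      (c * p , r + c * s + c * (i * p) , bound , subst (SumOf S _) (sym (·-assoc c p u′)) sum′)
      where
      open ≤-Reasoning
      bound : r + c * s + c * (i * p) < suc (j + i) * (c * p)
      bound = begin-strict
        r + c * s + c * (i * p)                     <⟨ +-monoˡ-< (c * (i * p)) (+-monoˡ-< (c * s) r<kc) ⟩
        suc k * c + c * s + c * (i * p)             ≡⟨ e₁ k c s (i * p) ⟩
        (suc (k + s) + i * p) * c                   ≡⟨ cong (λ z → (suc z + i * p) * c) k+s ⟩
        (suc v + p * j + i * p) * c                 ≤⟨ *-monoˡ-≤ c (+-monoˡ-≤ (i * p) (+-monoˡ-≤ (p * j) v<p)) ⟩
        (p + p * j + i * p) * c                     ≡⟨ e₂ p j i c ⟩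
        suc (j + i) * (c * p)                       ∎
        where
        e₁ : ∀ k c s x → suc k * c + c * s + c * x ≡ (suc (k + s) + x) * c
        e₁ = solve-∀
        e₂ : ∀ p j i c → (p + p * j + i * p) * c ≡ suc (j + i) * (c * p)
        e₂ = solve-∀

-- Counting digits

-- a ≤α n says that at least a of the base-p digits of n satisfy Z.
module DigitCount (p : ℕ) (Z : ℕ → Set) where

  infix 4 _≤α_

  data _≤α_ : ℕ → ℕ → Set where
    none  : ∀ {n} → 0 ≤α n
    skip  : ∀ {v m a} → v < p → a ≤α m → a ≤α (v + p * m)
    count : ∀ {v m a} → v < p → Z v → a ≤α m → suc a ≤α (v + p * m)

  ≤α-pred : ∀ {a n} → suc a ≤α n → a ≤α n
  ≤α-pred {zero}  _               = none
  ≤α-pred {suc a} (skip v<p h)    = skip v<p (≤α-pred h)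
  ≤α-pred {suc a} (count v<p _ h) = skip v<p h

  module _ (¬Z0 : ¬ Z 0) where

    -- Subtracting 1 lowers one nonzero digit and turns zeros, which are not in Z, into p - 1.
    ≤α-pred₂ : ∀ {a k n} → suc a ≤α k → k ≡ suc n → a ≤α n
    ≤α-pred₂ {a} (skip {suc v} {m} v<p h) refl = skip (<⇒≤ v<p) (≤α-pred h)
    ≤α-pred₂ {a} (count {zero} _ Z0 _) _ = ⊥-elim (¬Z0 Z0)
    ≤α-pred₂ {a} (count {suc v} v<p _ h) refl = skip (<⇒≤ v<p) h
    ≤α-pred₂ {a} (skip {zero} {zero} v<p h) eq with trans (sym (*-zeroʳ p)) eq
    ... | ()
    ≤α-pred₂ {a} {n = n} (skip {zero} {suc m} v<p h) eq = subst (a ≤α_) eq′ (skip p-1<p (≤α-pred₂ h refl))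
      where
      instance
        p≢0 : NonZero p
        p≢0 = ℕ.>-nonZero v<p
      p-1<p : ℕ.pred p < p
      p-1<p = ≤-reflexive (suc-pred p)
      eq′ : ℕ.pred p + p * m ≡ n
      eq′ = suc-injective (trans (cong (_+ p * m) (suc-pred p)) (trans (sym (*-suc p m)) eq))

    ≤α-∸ : ∀ j {a m} → a ≤α (m + j) → (a ∸ j) ≤α m
    ≤α-∸ zero    {a} {m} h = subst (a ≤α_) (+-identityʳ m) h
    ≤α-∸ (suc j) {zero}  h = none
    ≤α-∸ (suc j) {suc a} {m} h = ≤α-∸ j (≤α-pred₂ h (+-suc m j))

    -- Leading zeros may be split off forever, so a count at n = 0 is bounded only because 0 does
    -- not satisfy Z. It covers the one index whose quotient by p is not smaller.
    ≤α-0 : ∀ {a n} → a ≤α n → n ≡ 0 → a ≡ 0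
    ≤α-0 none _ = refl
    ≤α-0 (skip {zero} {m} v<p h) eq with m*n≡0⇒m≡0∨n≡0 p eq
    ... | inj₁ refl = ⊥-elim (n≮0 v<p)
    ... | inj₂ m≡0  = ≤α-0 h m≡0
    ≤α-0 (count {zero} v<p Z0 h) _ = ⊥-elim (¬Z0 Z0)

-- Divisibility by powers of p

prime-power-coprime : ∀ {p n} → Prime p → ¬ p ∣ n → ∀ a → Coprime (p ^ a) n
prime-power-coprime pr p∤n zero    (d∣1 , _) = ∣1⇒≡1 d∣1
prime-power-coprime {p} {n} pr p∤n (suc a) (d∣ , d∣n) =
  prime-power-coprime pr p∤n a (coprime-factors p-coprime (d∣ , ∣m⇒∣m*n (p ^ a) d∣n) , d∣n)
  where
  p-coprime : Coprime p n
  p-coprime (d∣p , d∣n) with prime⇒irreducible pr d∣p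
  ... | inj₁ d≡1  = d≡1
  ... | inj₂ refl = ⊥-elim (p∤n d∣n)

module PrimePower (p : ℕ) where

  infix 4 _⊢_

  -- A record, so that the exponent can be inferred.
  record _⊢_ (a : ℕ) (x : ℤ) : Set where
    constructor mk
    field divisible : + (p ^ a) ℤS.∣ x
  open _⊢_ public

  ⊢-+ : ∀ {a x y} → a ⊢ x → a ⊢ y → a ⊢ x ℤ.+ y
  ⊢-+ (mk h) (mk h′) = mk (ℤS.∣m∣n⇒∣m+n h h′)

  ⊢-- : ∀ {a x y} → a ⊢ x → a ⊢ y → a ⊢ x ℤ.- y
  ⊢-- (mk h) (mk h′) = mk (ℤS.∣m∣n⇒∣m-n h h′)

  ⊢-≡ : ∀ {a x y} → x ≡ y → a ⊢ x → a ⊢ y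
  ⊢-≡ {a} = subst (a ⊢_)

  ⊢-mono : ∀ {a b x} → b ≤ a → a ⊢ x → b ⊢ x
  ⊢-mono {a} {b} b≤a (mk h) = mk (ℤS.∣-trans (ℤS.∣ᵤ⇒∣ (divides (p ^ (a ∸ b))
    (trans (cong (p ^_) (sym (m∸n+n≡m b≤a))) (^-distribˡ-+-* p (a ∸ b) b)))) h)

  ⊢-* : ∀ {a b x y} → a ⊢ x → b ⊢ y → a + b ⊢ x ℤ.* y
  ⊢-* {a} {b} (mk (ℤS.divides q refl)) (mk (ℤS.divides r refl)) = mk (ℤS.divides (q ℤ.* r)
    (trans (regroup q (+ (p ^ a)) r (+ (p ^ b))) (cong (λ t → q ℤ.* r ℤ.* t)
      (trans (sym (ℤₚ.pos-* (p ^ a) (p ^ b))) (cong +_ (sym (^-distribˡ-+-* p a b)))))))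
    where
    regroup : ∀ q s r t → q ℤ.* s ℤ.* (r ℤ.* t) ≡ q ℤ.* r ℤ.* (s ℤ.* t)
    regroup = ℤR.solve-∀

  ⊢-*ˡ : ∀ {a} x {y} → a ⊢ y → a ⊢ x ℤ.* y
  ⊢-*ˡ x (mk h) = mk (ℤS.∣n⇒∣m*n x h)

  ⊢-*ʳ : ∀ {a x} y → a ⊢ x → a ⊢ x ℤ.* y
  ⊢-*ʳ y (mk h) = mk (ℤS.∣m⇒∣m*n y h)

  ⊢-zero : ∀ {x} → 0 ⊢ x
  ⊢-zero {x} = mk (ℤS.divides x (sym (ℤₚ.*-identityʳ x)))

  ⊢-0 : ∀ {a} → a ⊢ + 0
  ⊢-0 = mk (ℤS.divides (+ 0) refl)

  ⊢-1 : ∀ {x} → p ∣ ℤ.∣ x ∣ → 1 ⊢ x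
  ⊢-1 {x} h = mk (ℤS.∣ᵤ⇒∣ (subst (_∣ ℤ.∣ x ∣) (sym (*-identityʳ p)) h))

  ⊢-1⁻¹ : ∀ {x} → 1 ⊢ x → p ∣ ℤ.∣ x ∣
  ⊢-1⁻¹ {x} (mk h) = subst (_∣ ℤ.∣ x ∣) (*-identityʳ p) (ℤS.∣⇒∣ᵤ h)

  ⊢-cancel : Prime p → ∀ {a} c {x} → ¬ p ∣ ℤ.∣ c ∣ → a ⊢ c ℤ.* x → a ⊢ x
  ⊢-cancel pr {a} c {x} p∤c (mk h) = mk (ℤS.∣ᵤ⇒∣ (coprime-divisor {o = ℤ.∣ x ∣} (prime-power-coprime pr p∤c a)
    (subst (p ^ a ∣_) (ℤₚ.abs-* c x) (ℤS.∣⇒∣ᵤ h))))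

  ⊢-+-cancelʳ : ∀ {a x y} → a ⊢ x ℤ.+ y → a ⊢ y → a ⊢ x
  ⊢-+-cancelʳ {x = x} (mk h) (mk h′) = mk (ℤS.∣m+n∣n⇒∣m {m = x} h h′)

-- The recurrence given by the operator

sumℤ : ℕ → (ℕ → ℤ) → ℤ
sumℤ zero    f = + 0
sumℤ (suc n) f = f 0 ℤ.+ sumℤ n (λ i → f (suc i))

module _ {p : ℕ} where
  open PrimePower p

  sumℤ-⊢ : ∀ {a} n (f : ℕ → ℤ) → (∀ i → a ⊢ f i) → a ⊢ sumℤ n f
  sumℤ-⊢ zero    f h = ⊢-0
  sumℤ-⊢ (suc n) f h = ⊢-+ (h 0) (sumℤ-⊢ n _ (λ i → h (suc i)))

sumℤ-combine : ∀ n (f g : ℕ → ℤ) c → sumℤ n (λ i → f i ℤ.- g i ℤ.* c) ≡ sumℤ n f ℤ.- sumℤ n g ℤ.* c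
sumℤ-combine zero    f g c = sym (trans (ℤₚ.+-identityˡ _) (cong ℤ.-_ (ℤₚ.*-zeroˡ c)))
sumℤ-combine (suc n) f g c = trans (cong (λ t → f 0 ℤ.- g 0 ℤ.* c ℤ.+ t) (sumℤ-combine n _ _ c))
  (regroup (f 0) (g 0) c (sumℤ n (λ i → f (suc i))) (sumℤ n (λ i → g (suc i))))
  where
  regroup : ∀ a b c s t → a ℤ.- b ℤ.* c ℤ.+ (s ℤ.- t ℤ.* c) ≡ a ℤ.+ s ℤ.- (b ℤ.+ t) ℤ.* c
  regroup = ℤR.solve-∀

-- The k-th summand of the coefficient of z^m in L f_A, where c k is the function x ↦ P_k(x).
term : (ℕ → ℕ → ℤ) → (ℕ → ℤ) → ℕ → ℕ → ℤ
term c A m k = if does (k ≤? m) then c k (m ∸ k) ℤ.* A (m ∸ k) else + 0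

term-≤ : ∀ c A {m k} → k ≤ m → term c A m k ≡ c k (m ∸ k) ℤ.* A (m ∸ k)
term-≤ c A {m} {k} k≤m =
  cong (λ b → if b then c k (m ∸ k) ℤ.* A (m ∸ k) else + 0) (dec-true (k ≤? m) k≤m)

term-> : ∀ c A {m k} → m < k → term c A m k ≡ + 0
term-> c A {m} {k} m<k =
  cong (λ b → if b then c k (m ∸ k) ℤ.* A (m ∸ k) else + 0) (dec-false (k ≤? m) (<⇒≱ m<k))

module Recurrence {p : ℕ} (pr : Prime p) (c : ℕ → ℕ → ℤ) (A : ℕ → ℤ) where
  open PrimePower p

  module _
    (periodic : ∀ k x y → 1 ⊢ c k (x + p * y) ℤ.- c k x)
    (unit : ∀ v → 0 < v → v < p → ¬ p ∣ ℤ.∣ c 0 v ∣)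
    (A0≡1 : A 0 ≡ + 1)
    where

    -- Modulo p^(a+1) the values A(v + pm), v < p, obey the recurrence satisfied
    -- modulo p by the A(v), with initial value A(pm) instead of 1.
    lucas : ∀ {N K a m w} →
      (∀ n → N ⊢ sumℤ (suc K) (term c A n)) → suc a ≤ N → w < p →
      (∀ v → v < p → a ⊢ A (v + p * m)) →
      (∀ k v → 0 < v → v ≤ w → v < k → k ≤ v + p * m →
        suc a ⊢ c k (v + p * m ∸ k) ℤ.* A (v + p * m ∸ k)) →
      suc a ⊢ A (w + p * m) ℤ.- A w ℤ.* A (p * m)
    lucas {N} {K} {a} {m} {w} recurrence a<N w<p p^a∣A killed = <-rec Claim step w ≤-refl
      where
      B : ℕ → ℤ
      B v = A (v + p * m) ℤ.- A v ℤ.* A (p * m)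
      Claim : ℕ → Set
      Claim v = v ≤ w → suc a ⊢ B v
      -- Replacing P_k(x + pm) by P_k(x) costs only a multiple of p, and A(x + pm) contributes the
      -- remaining p^a.
      split : ∀ k x → x < p →
        suc a ⊢ (c k (x + p * m) ℤ.- c k x) ℤ.* A (x + p * m)
      split k x x<p = ⊢-* {1} {a} (periodic k x m) (p^a∣A x x<p)
      regroup : ∀ c′ c a b e → (c′ ℤ.- c) ℤ.* a ℤ.+ c ℤ.* (a ℤ.- b ℤ.* e) ≡ c′ ℤ.* a ℤ.- c ℤ.* b ℤ.* e
      regroup = ℤR.solve-∀
      step : ∀ v → (∀ {x} → x < v → Claim x) → Claim v
      step zero    _  _   = ⊢-≡ (sym B0) ⊢-0
        where
        B0 : B 0 ≡ + 0
        B0 = trans (cong (λ t → A (p * m) ℤ.- t ℤ.* A (p * m)) A0≡1)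
               (trans (cong (λ t → A (p * m) ℤ.- t) (ℤₚ.*-identityˡ (A (p * m)))) (ℤₚ.+-inverseʳ (A (p * m))))
      step v@(suc v′) ih v≤w = ⊢-cancel pr (c 0 v) (unit v (s≤s z≤n) v<p)
        (⊢-≡ (cancel (c 0 (v + p * m)) (c 0 v) (A (v + p * m)) (A v) (A (p * m)))
          (⊢-- head (split 0 v v<p)))
        where
        v<p : v < p
        v<p = ≤-<-trans v≤w w<p
        -- The recurrence at v + pm minus A(pm) times the recurrence at v, summand by summand. The
        -- latter is needed only modulo p, since A(pm) is a multiple of p^a.
        f : ℕ → ℤ
        f k = term c A (v + p * m) k ℤ.- term c A v k ℤ.* A (p * m)
        total : suc a ⊢ sumℤ (suc K) f
        total = ⊢-≡ (sym (sumℤ-combine (suc K) (term c A (v + p * m)) (term c A v) (A (p * m))))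
          (⊢-- (⊢-mono a<N (recurrence (v + p * m)))
               (⊢-* {1} {a} (⊢-mono (≤-trans (s≤s z≤n) a<N) (recurrence v)) (p^a∣A 0 (≤-<-trans z≤n w<p))))
        tail : ∀ k → suc a ⊢ f (suc k)
        tail k′ with suc k′ ≤? v
        ... | yes k≤v = ⊢-≡ (sym value)
                (⊢-+ (split k x (≤-<-trans (m∸n≤m v k) v<p)) (⊢-*ˡ (c k x) Bx))
          where
          k x : ℕ
          k = suc k′
          x = v ∸ k
          Bx : suc a ⊢ B x
          Bx = ih (s≤s (m∸n≤m v′ k′)) (≤-trans (m∸n≤m v k) v≤w)
          value : f k ≡ (c k (x + p * m) ℤ.- c k x) ℤ.* A (x + p * m) ℤ.+ c k x ℤ.* B x
          value = trans
            (cong₂ (λ s t → s ℤ.- t ℤ.* A (p * m))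
              (trans (term-≤ c A (≤-trans k≤v (m≤m+n v (p * m))))
                (cong (λ t → c k t ℤ.* A t) (+-∸-comm (p * m) k≤v)))
              (term-≤ c A k≤v))
            (sym (regroup (c k (x + p * m)) (c k x) (A (x + p * m)) (A x) (A (p * m))))
        -- The recurrence at v has no such summand; the one at v + pm, if present, has index below
        -- pm and is negligible by `killed`.
        ... | no k≰v = ⊢-≡ (sym value) killed′
          where
          k : ℕ
          k = suc k′
          v<k : v < k
          v<k = ≰⇒> k≰v
          value : f k ≡ term c A (v + p * m) k
          value = trans (cong (λ t → term c A (v + p * m) k ℤ.- t ℤ.* A (p * m)) (term-> c A v<k))
            (trans (cong (λ t → term c A (v + p * m) k ℤ.- t) (ℤₚ.*-zeroˡ (A (p * m)))) (ℤₚ.+-identityʳ _))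
          killed′ : suc a ⊢ term c A (v + p * m) k
          killed′ with k ≤? v + p * m
          ... | yes k≤ = ⊢-≡ (sym (term-≤ c A k≤)) (killed k v (s≤s z≤n) v≤w v<k k≤)
          ... | no k≰  = ⊢-≡ (sym (term-> c A (≰⇒> k≰))) ⊢-0
        head : suc a ⊢ f 0
        head = ⊢-+-cancelʳ total (sumℤ-⊢ K _ tail)
        cancel : ∀ c′ c a b e → c′ ℤ.* a ℤ.- c ℤ.* b ℤ.* e ℤ.- (c′ ℤ.- c) ℤ.* a ≡ c ℤ.* (a ℤ.- b ℤ.* e)
        cancel = ℤR.solve-∀

-- The induction on n = k + m

module Supercongruence
  {p : ℕ} (pr : Prime p) {S : Vec ℤ d → Set} {M : List (Vec ℤ d)} (SM : All S M)
  (origin : ∀ {r c u} → r < c → SumOf S r (c · u) → u ≡ 0ᵥ) where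

  open PrimePower p
  open Expansion pr SM

  private instance
    p≢0 : NonZero p
    p≢0 = prime⇒nonZero pr

  1<p : 1 < p
  1<p = ℕ.nonTrivial⇒n>1 p {{prime⇒nonTrivial pr}}

  A : ℕ → ℕ
  A n = pow M n δ 0ᵥ

  A0≡1 : A 0 ≡ 1
  A0≡1 = cong (λ b → if b then 1 else 0) (dec-true (0ᵥ {d} ≟ᵥ 0ᵥ) refl)

  open DigitCount p (λ v → p ∣ A v) public

  p∤A0 : ¬ p ∣ A 0
  p∤A0 p∣A0 = <⇒≢ 1<p (sym (∣1⇒≡1 (subst (p ∣_) A0≡1 p∣A0)))

  Claim : ℕ → ℕ → Set
  Claim a n = ∀ k m u → k + m ≡ n → Below S k u → p ^ a ∣ p ^ k * pow M m δ u

  below-0 : ∀ {u} → u ≡ 0ᵥ → Below S 0 u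
  below-0 refl = 1 , 0 , s≤s z≤n , subst (SumOf S 0) (sym (·-zeroʳ 1)) nil

  claim⇒A : ∀ {a n} → Claim a n → a ⊢ + A n
  claim⇒A {a} {n} claim = mk (ℤS.∣ᵤ⇒∣ (subst (p ^ a ∣_) (*-identityˡ (A n)) (claim 0 n 0ᵥ refl (below-0 refl))))

  -- Write m′ = s + tp and j = m - t, so that k + s = v + pj. Each term of the expansion has weight
  -- j + i and power t′ with (j + i) + t′ = m, which is an instance of `Claim a m`. For j ≥ 1, s ≤ p
  -- - 1 gives k ≥ v + pj - (p - 1) ≥ v + j. Hence p^j in place of p^k is already enough, and k - j
  -- factors p are saved.
  lift : ∀ {a m v} → v < p → Claim a m → ∀ k m′ u → k + m′ ≡ v + p * m → Below S k u →
    ∃ λ j → (v + j ≤ k ⊎ j ≡ 0) × p ^ a ∣ p ^ j * pow M m′ δ u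
  lift {a} {m} {v} v<p claim k m′ u eq below = j , bound j k+s ,
    subst (λ z → p ^ a ∣ p ^ j * pow M z δ u) (sym (m≡m%n+[m/n]*n m′ p))
      (expansion {p ^ a} {p ^ j} {j} {v} t s k u v<p k+s below hyp)
    where
    s t j : ℕ
    s = m′ % p
    t = m′ / p
    j = m ∸ t
    t≤m : t ≤ m
    t≤m = ≮⇒≥ λ m<t → <-irrefl refl (begin-strict
      m′               ≤⟨ m≤n+m m′ k ⟩
      k + m′           ≡⟨ eq ⟩
      v + p * m        <⟨ +-monoˡ-< (p * m) v<p ⟩
      p + p * m        ≡⟨ *-suc p m ⟨
      p * suc m        ≤⟨ *-monoʳ-≤ p m<t ⟩
      p * t            ≡⟨ *-comm p t ⟩
      t * p            ≤⟨ m≤n+m (t * p) s ⟩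
      s + t * p        ≡⟨ m≡m%n+[m/n]*n m′ p ⟨
      m′               ∎)
      where open ≤-Reasoning
    k+s : k + s ≡ v + p * j
    k+s = +-cancelʳ-≡ (p * t) (k + s) (v + p * j) (begin
      k + s + p * t        ≡⟨ trans (cong (λ z → k + s + z) (*-comm p t)) (+-assoc k s (t * p)) ⟩
      k + (s + t * p)      ≡⟨ cong (λ z → k + z) (m≡m%n+[m/n]*n m′ p) ⟨
      k + m′               ≡⟨ eq ⟩
      v + p * m            ≡⟨ cong (λ z → v + p * z) (m∸n+n≡m t≤m) ⟨
      v + p * (j + t)      ≡⟨ trans (cong (λ z → v + z) (*-distribˡ-+ p j t)) (sym (+-assoc v (p * j) (p * t))) ⟩
      v + p * j + p * t    ∎)
      where open ≡-Reasoning
    bound : ∀ j → k + s ≡ v + p * j → v + j ≤ k ⊎ j ≡ 0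
    bound zero     _   = inj₂ refl
    bound (suc j′) k+s = inj₁ (+-cancelʳ-≤ p (v + suc j′) k (begin
      v + suc j′ + p       ≡⟨ e₁ v j′ p ⟩
      v + p + j′ + 1       ≤⟨ +-monoˡ-≤ 1 (+-monoʳ-≤ (v + p) (m≤n*m j′ p)) ⟩
      v + p + p * j′ + 1   ≡⟨ e₂ v p j′ ⟩
      v + p * suc j′ + 1   ≡⟨ cong (_+ 1) k+s ⟨
      k + s + 1            ≡⟨ e₃ k s ⟩
      k + suc s            ≤⟨ +-monoʳ-≤ k (m%n<n m′ p) ⟩
      k + p                ∎))
      where
      open ≤-Reasoning
      e₁ : ∀ v j p → v + suc j + p ≡ v + p + j + 1
      e₁ = solve-∀
      e₂ : ∀ v p j → v + p + p * j + 1 ≡ v + p * suc j + 1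
      e₂ = solve-∀
      e₃ : ∀ k s → k + s + 1 ≡ k + suc s
      e₃ = solve-∀
    hyp : ∀ i t′ u′ → i + t′ ≡ t → Below S (j + i) u′ → p ^ a ∣ p ^ j * (p ^ i * pow M t′ δ u′)
    hyp i t′ u′ eq′ below′ = subst (p ^ a ∣_)
      (trans (cong (_* pow M t′ δ u′) (^-distribˡ-+-* p j i)) (*-assoc (p ^ j) (p ^ i) _))
      (claim (j + i) t′ u′ (trans (+-assoc j i t′) (trans (cong (λ z → j + z) eq′) (m∸n+n≡m t≤m))) below′)

  raise : ∀ {a b j k x} → b + j ≤ k → p ^ a ∣ p ^ j * x → p ^ (b + a) ∣ p ^ k * x
  raise {a} {b} {j} {k} {x} b+j≤k (divides q eq) = divides (p ^ (k ∸ (b + j)) * q) (begin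
    p ^ k * x                                  ≡⟨ cong (λ z → p ^ z * x) (m∸n+n≡m b+j≤k) ⟨
    p ^ (k ∸ (b + j) + (b + j)) * x            ≡⟨ cong (_* x) (trans (^-distribˡ-+-* p (k ∸ (b + j)) (b + j))
                                                    (cong (p ^ (k ∸ (b + j)) *_) (^-distribˡ-+-* p b j))) ⟩
    p ^ (k ∸ (b + j)) * (p ^ b * p ^ j) * x    ≡⟨ e₁ (p ^ (k ∸ (b + j))) (p ^ b) (p ^ j) x ⟩
    p ^ (k ∸ (b + j)) * p ^ b * (p ^ j * x)    ≡⟨ cong (p ^ (k ∸ (b + j)) * p ^ b *_) eq ⟩
    p ^ (k ∸ (b + j)) * p ^ b * (q * p ^ a)    ≡⟨ e₂ (p ^ (k ∸ (b + j))) (p ^ b) q (p ^ a) ⟩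
    p ^ (k ∸ (b + j)) * q * (p ^ b * p ^ a)    ≡⟨ cong (p ^ (k ∸ (b + j)) * q *_) (^-distribˡ-+-* p b a) ⟨
    p ^ (k ∸ (b + j)) * q * p ^ (b + a)        ∎)
    where
    open ≡-Reasoning
    e₁ : ∀ K B J x → K * (B * J) * x ≡ K * B * (J * x)
    e₁ = solve-∀
    e₂ : ∀ K B q A → K * B * (q * A) ≡ K * q * (B * A)
    e₂ = solve-∀

  bounded⇒≤ : ∀ {v j k} → v + j ≤ k ⊎ j ≡ 0 → j ≤ k
  bounded⇒≤ {v} {j} (inj₁ v+j≤k) = ≤-trans (m≤n+m j v) v+j≤k
  bounded⇒≤ (inj₂ refl) = z≤n

  bounded⇒< : ∀ {v j k} → 0 < v → 0 < k → v + j ≤ k ⊎ j ≡ 0 → j < k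
  bounded⇒< {j = j} 0<v 0<k (inj₁ v+j≤k) = ≤-trans (+-monoˡ-≤ j 0<v) v+j≤k
  bounded⇒< 0<v 0<k (inj₂ refl) = 0<k

  lift-claim : ∀ {a m v} → v < p → Claim a m → Claim a (v + p * m)
  lift-claim {a} v<p claim k m′ u eq below with lift {a} v<p claim k m′ u eq below
  ... | j , bound , p^a∣ = raise {a} {0} (bounded⇒≤ bound) p^a∣

  quotient< : ∀ {v m} → v + p * m ≢ 0 → m < v + p * m
  quotient< {v} {zero}  ≢0 = n≢0⇒n>0 ≢0
  quotient< {v} {suc m} _  = ≤-trans (m<m*n (suc m) p 1<p)
    (≤-trans (≤-reflexive (*-comm (suc m) p)) (m≤n+m (p * suc m) v))

  module _
    (c : ℕ → ℕ → ℤ) {N K : ℕ}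
    (periodic : ∀ k x y → 1 ⊢ c k (x + p * y) ℤ.- c k x)
    (unit : ∀ v → 0 < v → v < p → ¬ p ∣ ℤ.∣ c 0 v ∣)
    (recurrence : ∀ n → N ⊢ sumℤ (suc K) (term c (λ n → + A n) n))
    (killed : ∀ {a m} k v → a ≤α m → suc a ≤ N → 0 < v → v < p → v < k → k ≤ v + p * m →
      (∀ x b → x < v + p * m → b ≤ N → b ≤α x → b ⊢ + A x) →
      suc a ⊢ c k (v + p * m ∸ k) ℤ.* + A (v + p * m ∸ k))
    where

    -- Recursion on the quotient by p would serve the expansion alone; strong induction is used
    -- because `killed` consults A at other smaller indices.
    claim : ∀ n a → a ≤ N → a ≤α n → Claim a n
    claim = <-rec (λ n → ∀ a → a ≤ N → a ≤α n → Claim a n) step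
      where
      step : ∀ n → (∀ {x} → x < n → ∀ a → a ≤ N → a ≤α x → Claim a x) → ∀ a → a ≤ N → a ≤α n → Claim a n
      step n ih _ _ none k m u _ _ = 1∣ _
      step n ih a a≤N (skip {v} {m′} v<p h) with v + p * m′ ℕ.≟ 0
      ... | yes ≡0 rewrite ≤α-0 p∤A0 {a} (skip v<p h) ≡0 = λ k m u _ _ → 1∣ _
      ... | no ≢0  = lift-claim {a} v<p (ih (quotient< {v} {m′} ≢0) a a≤N h)
      step n ih (suc a) a<N (count {zero} _ Z0 _) = ⊥-elim (p∤A0 Z0)
      step n ih (suc a) a<N (count {v@(suc _)} {m′} v<p Zv h) (suc k) m u eq below
        with lift {a} v<p (ih (quotient< {v} {m′} (λ ())) a (<⇒≤ a<N) h) (suc k) m u eq below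
      ... | j , bound , p^a∣ = raise {a} {1} (bounded⇒< (s≤s z≤n) (s≤s z≤n) bound) p^a∣
      step n ih (suc a) a<N (count {v@(suc _)} {m′} v<p Zv h) zero m u refl (c′ , r , r<c , sum)
        with origin (subst (r <_) (*-identityˡ c′) r<c) sum
      ... | refl = subst (p ^ suc a ∣_) (sym (*-identityˡ (A m))) (ℤS.∣⇒∣ᵤ (divisible final))
        where
        claim′ : Claim a m′
        claim′ = ih (quotient< {v} {m′} (λ ())) a (<⇒≤ a<N) h
        p^a∣A : ∀ w → w < p → a ⊢ + A (w + p * m′)
        p^a∣A w w<p = claim⇒A {a} (lift-claim {a} w<p claim′)
        congruence : suc a ⊢ + A (v + p * m′) ℤ.- + A v ℤ.* + A (p * m′)
        -- The negligible summands of the recurrence at w + pm′, w ≤ v, have indices below v + pm′,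
        -- so the induction hypothesis covers them.
        congruence = Recurrence.lucas pr c (λ n → + A n) periodic unit (cong +_ A0≡1) {N} {K} {a} {m′} {v}
          recurrence a<N v<p p^a∣A (λ k w 0<w w≤v w<k k≤ → killed k w h a<N 0<w (≤-<-trans w≤v v<p) w<k k≤
            (λ x b x< b≤N h′ → claim⇒A {b} (ih (<-≤-trans x< (+-monoˡ-≤ (p * m′) w≤v)) b b≤N h′)))
        final : suc a ⊢ + A (v + p * m′)
        final = ⊢-+-cancelʳ {y = ℤ.- (+ A v ℤ.* + A (p * m′))} congruence
          (⊢-≡ (ℤₚ.+-identityˡ _) (⊢-- ⊢-0 (⊢-* {1} {a} (⊢-1 {+ A v} Zv) (p^a∣A 0 (<-trans (s≤s z≤n) 1<p)))))

    p^α∣A : ∀ {n a} → a ≤ N → a ≤α n → a ⊢ + A n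
    p^α∣A {n} {a} a≤N h = claim⇒A {a} (claim n a a≤N h)

-- The Newton polyhedron

toℚᵘ-toℚ : ∀ a → ℚ.toℚᵘ (toℚ a) ℚᵘ.≃ ℚᵘ.mkℚᵘ a 0
toℚᵘ-toℚ a = ℚₚ.toℚᵘ-fromℚᵘ (ℚᵘ.mkℚᵘ a 0)

toℚ-+ : ∀ a b → toℚ (a ℤ.+ b) ≡ toℚ a ℚ.+ toℚ b
toℚ-+ a b = ℚₚ.toℚᵘ-injective (begin
  ℚ.toℚᵘ (toℚ (a ℤ.+ b))                   ≈⟨ toℚᵘ-toℚ (a ℤ.+ b) ⟩
  ℚᵘ.mkℚᵘ (a ℤ.+ b) 0                      ≈⟨ ℚᵘ.*≡* (cong₂ (λ x y → (x ℤ.+ y) ℤ.* + 1) (sym (ℤₚ.*-identityʳ a)) (sym (ℤₚ.*-identityʳ b))) ⟩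
  ℚᵘ.mkℚᵘ a 0 ℚᵘ.+ ℚᵘ.mkℚᵘ b 0             ≈⟨ ℚᵘₚ.+-cong (toℚᵘ-toℚ a) (toℚᵘ-toℚ b) ⟨
  ℚ.toℚᵘ (toℚ a) ℚᵘ.+ ℚ.toℚᵘ (toℚ b)       ≈⟨ ℚₚ.toℚᵘ-homo-+ (toℚ a) (toℚ b) ⟨
  ℚ.toℚᵘ (toℚ a ℚ.+ toℚ b)                 ∎)
  where open ℚᵘₚ.≃-Reasoning

toℚ-* : ∀ a b → toℚ (a ℤ.* b) ≡ toℚ a ℚ.* toℚ b
toℚ-* a b = ℚₚ.toℚᵘ-injective (begin
  ℚ.toℚᵘ (toℚ (a ℤ.* b))                   ≈⟨ toℚᵘ-toℚ (a ℤ.* b) ⟩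
  ℚᵘ.mkℚᵘ a 0 ℚᵘ.* ℚᵘ.mkℚᵘ b 0             ≈⟨ ℚᵘₚ.*-cong (toℚᵘ-toℚ a) (toℚᵘ-toℚ b) ⟨
  ℚ.toℚᵘ (toℚ a) ℚᵘ.* ℚ.toℚᵘ (toℚ b)       ≈⟨ ℚₚ.toℚᵘ-homo-* (toℚ a) (toℚ b) ⟨
  ℚ.toℚᵘ (toℚ a ℚ.* toℚ b)                 ∎)
  where open ℚᵘₚ.≃-Reasoning

toℚ-mono-< : ∀ {m n} → m < n → toℚ (+ m) ℚ.< toℚ (+ n)
toℚ-mono-< {m} {n} m<n = ℚₚ.toℚᵘ-cancel-< (ℚᵘₚ.<-respˡ-≃ (ℚᵘₚ.≃-sym (toℚᵘ-toℚ (+ m)))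
  (ℚᵘₚ.<-respʳ-≃ (ℚᵘₚ.≃-sym (toℚᵘ-toℚ (+ n)))
    (ℚᵘ.*<* (ℤₚ.*-monoʳ-<-pos (+ 1) (ℤ.+<+ m<n)))))

_+ᵣ_ : Vec ℚ d → Vec ℚ d → Vec ℚ d
_+ᵣ_ = Vec.zipWith ℚ._+_

+ᵣ-assoc : (x y z : Vec ℚ d) → (x +ᵣ y) +ᵣ z ≡ x +ᵣ (y +ᵣ z)
+ᵣ-assoc []      []      []      = refl
+ᵣ-assoc (a ∷ x) (b ∷ y) (c ∷ z) = cong₂ _∷_ (ℚₚ.+-assoc a b c) (+ᵣ-assoc x y z)

+ᵣ-identityˡ : (x : Vec ℚ d) → Vec.replicate d 0ℚ +ᵣ x ≡ x
+ᵣ-identityˡ []      = refl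
+ᵣ-identityˡ (a ∷ x) = cong₂ _∷_ (ℚₚ.+-identityˡ a) (+ᵣ-identityˡ x)

combo-++ : (ws ws′ : List (Vec ℤ d × ℚ)) → combo (ws ++ ws′) ≡ combo ws +ᵣ combo ws′
combo-++ []             ws′ = sym (+ᵣ-identityˡ (combo ws′))
combo-++ ((e , w) ∷ ws) ws′ = trans (cong (Vec.map (λ z → w ℚ.* toℚ z) e +ᵣ_) (combo-++ ws ws′))
  (sym (+ᵣ-assoc (Vec.map (λ z → w ℚ.* toℚ z) e) (combo ws) (combo ws′)))

rescale : ℚ → List (Vec ℤ d × ℚ) → List (Vec ℤ d × ℚ)
rescale l = List.map (λ t → proj₁ t , l ℚ.* proj₂ t)

combo-rescale : ∀ l (ws : List (Vec ℤ d × ℚ)) → combo (rescale l ws) ≡ Vec.map (l ℚ.*_) (combo ws)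
combo-rescale l [] = zeros _
  where
  zeros : ∀ d → Vec.replicate d 0ℚ ≡ Vec.map (l ℚ.*_) (Vec.replicate d 0ℚ)
  zeros zero    = refl
  zeros (suc d) = cong₂ _∷_ (sym (ℚₚ.*-zeroʳ l)) (zeros d)
combo-rescale l ((e , w) ∷ ws) rewrite combo-rescale l ws = distribute e (combo ws)
  where
  distribute : ∀ {d} (e : Vec ℤ d) y → Vec.map (λ z → l ℚ.* w ℚ.* toℚ z) e +ᵣ Vec.map (l ℚ.*_) y
                                     ≡ Vec.map (l ℚ.*_) (Vec.map (λ z → w ℚ.* toℚ z) e +ᵣ y)
  distribute []      []      = refl
  distribute (z ∷ e) (b ∷ y) = cong₂ _∷_
    (trans (cong (ℚ._+ l ℚ.* b) (ℚₚ.*-assoc l w (toℚ z))) (sym (ℚₚ.*-distribˡ-+ l (w ℚ.* toℚ z) b))) (distribute e y)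

sum-++ : (xs ys : List ℚ) → sumℚ (xs ++ ys) ≡ sumℚ xs ℚ.+ sumℚ ys
sum-++ []       ys = sym (ℚₚ.+-identityˡ (sumℚ ys))
sum-++ (x ∷ xs) ys = trans (cong (x ℚ.+_) (sum-++ xs ys)) (sym (ℚₚ.+-assoc x (sumℚ xs) (sumℚ ys)))

sum-rescale : ∀ l (ws : List (Vec ℤ d × ℚ)) →
  sumℚ (List.map proj₂ (rescale l ws)) ≡ l ℚ.* sumℚ (List.map proj₂ ws)
sum-rescale l []             = sym (ℚₚ.*-zeroʳ l)
sum-rescale l ((e , w) ∷ ws) = trans (cong (l ℚ.* w ℚ.+_) (sum-rescale l ws)) (sym (ℚₚ.*-distribˡ-+ l w _))

-- With w = 1/c, a sum of r exponents equal to `c · u` turns into a combination of total weight r/c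
-- that represents u.
uniform : ∀ {S : Vec ℤ d → Set} w {r v} → SumOf S r v → List (Vec ℤ d × ℚ)
uniform w nil            = []
uniform w (cons {e} _ s) = (e , w) ∷ uniform w s

uniform-All : ∀ {S : Vec ℤ d → Set} {w} → 0ℚ ℚ.≤ w → ∀ {r v} (s : SumOf S r v) →
  All (λ t → S (proj₁ t) × 0ℚ ℚ.≤ proj₂ t) (uniform w s)
uniform-All 0≤w nil         = []
uniform-All 0≤w (cons Se s) = (Se , 0≤w) ∷ uniform-All 0≤w s

uniform-sum : ∀ {S : Vec ℤ d → Set} w {r v} (s : SumOf S r v) →
  sumℚ (List.map proj₂ (uniform w s)) ≡ toℚ (+ r) ℚ.* w
uniform-sum w nil = sym (ℚₚ.*-zeroˡ w)
uniform-sum w (cons {n = r} _ s) = begin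
  w ℚ.+ sumℚ (List.map proj₂ (uniform w s))   ≡⟨ cong₂ ℚ._+_ (sym (ℚₚ.*-identityˡ w)) (uniform-sum w s) ⟩
  1ℚ ℚ.* w ℚ.+ toℚ (+ r) ℚ.* w                ≡⟨ ℚₚ.*-distribʳ-+ w 1ℚ (toℚ (+ r)) ⟨
  (1ℚ ℚ.+ toℚ (+ r)) ℚ.* w                    ≡⟨ cong (ℚ._* w) (toℚ-+ (+ 1) (+ r)) ⟨
  toℚ (+ suc r) ℚ.* w                         ∎
  where open ≡-Reasoning

uniform-combo : ∀ {S : Vec ℤ d → Set} w {r v} (s : SumOf S r v) →
  combo (uniform w s) ≡ Vec.map (λ z → w ℚ.* toℚ z) v
uniform-combo w nil = zeros _
  where
  zeros : ∀ d → Vec.replicate d 0ℚ ≡ Vec.map (λ z → w ℚ.* toℚ z) (Vec.replicate d (+ 0))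
  zeros zero    = refl
  zeros (suc d) = cong₂ _∷_ (sym (ℚₚ.*-zeroʳ w)) (zeros d)
uniform-combo w (cons {e} {w = v} _ s) rewrite uniform-combo w s = distribute e v
  where
  distribute : ∀ {d} (e v : Vec ℤ d) → Vec.map (λ z → w ℚ.* toℚ z) e +ᵣ Vec.map (λ z → w ℚ.* toℚ z) v
                                     ≡ Vec.map (λ z → w ℚ.* toℚ z) (e +ᵥ v)
  distribute []      []      = refl
  distribute (x ∷ e) (y ∷ v) = cong₂ _∷_
    (trans (sym (ℚₚ.*-distribˡ-+ w (toℚ x) (toℚ y))) (cong (w ℚ.*_) (sym (toℚ-+ x y)))) (distribute e v)

-- With W = r/c < 1 and a ball of radius ε about 0 inside the polyhedron Δ, the ball of
-- radius (1 - W) ε about u lies in W Δ + (1 - W) Δ, so u is an interior point.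
interior-multiple : ∀ {p} {Λ : Laurent d} → OriginOnlyInterior p Λ →
  ∀ {r c u} → r < c → SumOf (InSupp p Λ) r (c · u) → u ≡ 0ᵥ
interior-multiple {d} {p} {Λ} ((ε , 0<ε , ball) , only) {r} {c@(suc _)} {u} r<c s =
  only u (l ℚ.* ε , 0<lε , inside)
  where
  instance
    c-pos : ℚ.Positive (toℚ (+ c))
    c-pos = ℚ.positive (toℚ-mono-< {0} {c} (ℕ.s≤s ℕ.z≤n))
    c≢0 : ℚ.NonZero (toℚ (+ c))
    c≢0 = ℚₚ.pos⇒nonZero (toℚ (+ c))
  w W l : ℚ
  w = ℚ.1/ toℚ (+ c)
  W = toℚ (+ r) ℚ.* w
  l = 1ℚ ℚ.- W
  instance
    w-pos : ℚ.Positive w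
    w-pos = ℚₚ.1/pos⇒pos (toℚ (+ c))
  0≤w : 0ℚ ℚ.≤ w
  0≤w = ℚₚ.<⇒≤ (ℚₚ.positive⁻¹ w)
  W<1 : W ℚ.< 1ℚ
  W<1 = subst (W ℚ.<_) (ℚₚ.*-inverseʳ (toℚ (+ c))) (ℚₚ.*-monoˡ-<-pos w (toℚ-mono-< r<c))
  0<l : 0ℚ ℚ.< l
  0<l = subst (ℚ._< l) (ℚₚ.+-inverseʳ W) (ℚₚ.+-monoˡ-< (ℚ.- W) W<1)
  instance
    l-pos : ℚ.Positive l
    l-pos = ℚ.positive 0<l
    l≢0 : ℚ.NonZero l
    l≢0 = ℚₚ.pos⇒nonZero l
  μ : ℚ
  μ = ℚ.1/ l
  instance
    μ-pos : ℚ.Positive μ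
    μ-pos = ℚₚ.1/pos⇒pos l
  0<lε : 0ℚ ℚ.< l ℚ.* ε
  0<lε = subst (ℚ._< l ℚ.* ε) (ℚₚ.*-zeroʳ l) (ℚₚ.*-monoʳ-<-pos l 0<ε)
  l+W : l ℚ.+ W ≡ 1ℚ
  l+W = trans (ℚₚ.+-assoc 1ℚ (ℚ.- W) W) (trans (cong (1ℚ ℚ.+_) (ℚₚ.+-inverseˡ W)) (ℚₚ.+-identityʳ 1ℚ))
  center : combo (uniform w s) ≡ Vec.map toℚ u
  center = trans (uniform-combo w s) (trans (sym (Vecₚ.map-∘ _ _ u)) (Vecₚ.map-cong cancel u))
    where
    cancel : ∀ z → w ℚ.* toℚ (+ c ℤ.* z) ≡ toℚ z
    cancel z = trans (cong (w ℚ.*_) (toℚ-* (+ c) z)) (trans (sym (ℚₚ.*-assoc w (toℚ (+ c)) (toℚ z)))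
      (trans (cong (ℚ._* toℚ z) (ℚₚ.*-inverseˡ (toℚ (+ c)))) (ℚₚ.*-identityˡ (toℚ z))))
  inside : ∀ v → (∀ i → ℚ.∣ Vec.lookup v i ℚ.- Vec.lookup (Vec.map toℚ u) i ∣ ℚ.< l ℚ.* ε) → InNewton p Λ v
  inside v close = combine (ball y y-close)
    where
    x y : Vec ℚ d
    x = Vec.map toℚ u
    -- Solves v = l y + x. Since v is within l ε of x, y is within ε of the origin and lies in the
    -- polyhedron; x carries the remaining weight W = 1 - l.
    y = Vec.zipWith (λ a b → (a ℚ.- b) ℚ.* μ) v x
    y-close : ∀ i → ℚ.∣ Vec.lookup y i ℚ.- Vec.lookup (Vec.replicate d 0ℚ) i ∣ ℚ.< ε
    y-close i = subst₂ ℚ._<_ (sym lhs) rhs (ℚₚ.*-monoˡ-<-pos μ (close i))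
      where
      δᵢ : ℚ
      δᵢ = Vec.lookup v i ℚ.- Vec.lookup x i
      lhs : ℚ.∣ Vec.lookup y i ℚ.- Vec.lookup (Vec.replicate d 0ℚ) i ∣ ≡ ℚ.∣ δᵢ ∣ ℚ.* μ
      lhs = trans (cong₂ (λ a b → ℚ.∣ a ℚ.- b ∣) (Vecₚ.lookup-zipWith _ i v x) (Vecₚ.lookup-replicate i 0ℚ))
        (trans (cong ℚ.∣_∣ (ℚₚ.+-identityʳ (δᵢ ℚ.* μ)))
        (trans (ℚₚ.∣p*q∣≡∣p∣*∣q∣ δᵢ μ) (cong (ℚ.∣ δᵢ ∣ ℚ.*_) (ℚₚ.0≤p⇒∣p∣≡p (ℚₚ.<⇒≤ (ℚₚ.positive⁻¹ μ))))))
      rhs : l ℚ.* ε ℚ.* μ ≡ ε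
      rhs = trans (cong (ℚ._* μ) (ℚₚ.*-comm l ε)) (trans (ℚₚ.*-assoc ε l μ)
        (trans (cong (ε ℚ.*_) (ℚₚ.*-inverseʳ l)) (ℚₚ.*-identityʳ ε)))
    recover : ∀ {d} (v x : Vec ℚ d) → Vec.map (l ℚ.*_) (Vec.zipWith (λ a b → (a ℚ.- b) ℚ.* μ) v x) +ᵣ x ≡ v
    recover []      []      = refl
    recover (a ∷ v) (b ∷ x) = cong₂ _∷_ coordinate (recover v x)
      where
      open ≡-Reasoning
      coordinate : l ℚ.* ((a ℚ.- b) ℚ.* μ) ℚ.+ b ≡ a
      coordinate = begin
        l ℚ.* ((a ℚ.- b) ℚ.* μ) ℚ.+ b   ≡⟨ cong (λ t → l ℚ.* t ℚ.+ b) (ℚₚ.*-comm (a ℚ.- b) μ) ⟩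
        l ℚ.* (μ ℚ.* (a ℚ.- b)) ℚ.+ b   ≡⟨ cong (ℚ._+ b) (ℚₚ.*-assoc l μ (a ℚ.- b)) ⟨
        l ℚ.* μ ℚ.* (a ℚ.- b) ℚ.+ b     ≡⟨ cong (λ t → t ℚ.* (a ℚ.- b) ℚ.+ b) (ℚₚ.*-inverseʳ l) ⟩
        1ℚ ℚ.* (a ℚ.- b) ℚ.+ b          ≡⟨ cong (ℚ._+ b) (ℚₚ.*-identityˡ (a ℚ.- b)) ⟩
        a ℚ.- b ℚ.+ b                   ≡⟨ ℚₚ.+-assoc a (ℚ.- b) b ⟩
        a ℚ.+ (ℚ.- b ℚ.+ b)             ≡⟨ cong (a ℚ.+_) (ℚₚ.+-inverseˡ b) ⟩
        a ℚ.+ 0ℚ                        ≡⟨ ℚₚ.+-identityʳ a ⟩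
        a                               ∎
    combine : InNewton p Λ y → InNewton p Λ v
    combine (ws , all , sum≡1 , combo≡y) = rescale l ws ++ uniform w s
      , Allₚ.++⁺ (Allₚ.map⁺ (All.map (λ { (Se , 0≤) → Se , scaled 0≤ }) all)) (uniform-All 0≤w s)
      , trans (cong sumℚ (Listₚ.map-++ proj₂ (rescale l ws) (uniform w s)))
          (trans (sum-++ (List.map proj₂ (rescale l ws)) _)
          (trans (cong₂ ℚ._+_ (trans (sum-rescale l ws) (trans (cong (l ℚ.*_) sum≡1) (ℚₚ.*-identityʳ l))) (uniform-sum w s))
          l+W))
      , trans (combo-++ (rescale l ws) (uniform w s))
          (trans (cong₂ _+ᵣ_ (trans (combo-rescale l ws) (cong (Vec.map (l ℚ.*_)) combo≡y)) center) (recover v x))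
      where
      scaled : ∀ {q} → 0ℚ ℚ.≤ q → 0ℚ ℚ.≤ l ℚ.* q
      scaled {q} 0≤q = subst (ℚ._≤ l ℚ.* q) (ℚₚ.*-zeroʳ l) (ℚₚ.*-monoˡ-≤-nonNeg l {{ℚₚ.pos⇒nonNeg l}} 0≤q)

-- Constant terms modulo p^N

-- The value of the linear functional x^e ↦ φ e on the level-N representative of Λ.
pair : Laurent d → ℕ → (Vec ℤ d → ℤ) → ℤ
pair []            N φ = + 0
pair ((e , x) ∷ Λ) N φ = x N ℤ.* φ e ℤ.+ pair Λ N φ

indicator : Vec ℤ d → Vec ℤ d → ℤ
indicator e u = if does (u ≟ᵥ e) then + 1 else + 0

coeffL-pair : ∀ (Λ : Laurent d) e N → coeffL Λ e N ≡ pair Λ N (indicator e)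
coeffL-pair []            e N = refl
coeffL-pair ((u , x) ∷ Λ) e N = cong₂ ℤ._+_ (choose (does (u ≟ᵥ e))) (coeffL-pair Λ e N)
  where
  choose : ∀ b → (if b then x else 0p) N ≡ x N ℤ.* (if b then + 1 else + 0)
  choose true  = sym (ℤₚ.*-identityʳ (x N))
  choose false = sym (ℤₚ.*-zeroʳ (x N))

pair-++ : ∀ (Λ Λ′ : Laurent d) N φ → pair (Λ ++ Λ′) N φ ≡ pair Λ N φ ℤ.+ pair Λ′ N φ
pair-++ []            Λ′ N φ = sym (ℤₚ.+-identityˡ _)
pair-++ ((e , x) ∷ Λ) Λ′ N φ = trans (cong (λ t → x N ℤ.* φ e ℤ.+ t) (pair-++ Λ Λ′ N φ))
  (sym (ℤₚ.+-assoc (x N ℤ.* φ e) (pair Λ N φ) (pair Λ′ N φ)))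

pair-mulL : ∀ (Λ Λ′ : Laurent d) N φ → pair (mulL Λ Λ′) N φ ≡ pair Λ N (λ e → pair Λ′ N (λ e′ → φ (e +ᵥ e′)))
pair-mulL []            Λ′ N φ = refl
pair-mulL ((e , x) ∷ Λ) Λ′ N φ = trans
  (pair-++ (List.map (λ s → e +ᵥ proj₁ s , x ⊗ proj₂ s) Λ′) (mulL Λ Λ′) N φ)
  (cong₂ ℤ._+_ (monomial Λ′) (pair-mulL Λ Λ′ N φ))
  where
  monomial : ∀ Λ′ → pair (List.map (λ s → e +ᵥ proj₁ s , x ⊗ proj₂ s) Λ′) N φ ≡
                    x N ℤ.* pair Λ′ N (λ e′ → φ (e +ᵥ e′))
  monomial []              = sym (ℤₚ.*-zeroʳ (x N))
  monomial ((e′ , y) ∷ Λ′) = trans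
    (cong₂ ℤ._+_ (ℤₚ.*-assoc (x N) (y N) (φ (e +ᵥ e′))) (monomial Λ′))
    (sym (ℤₚ.*-distribˡ-+ (x N) (y N ℤ.* φ (e +ᵥ e′)) (pair Λ′ N (λ e″ → φ (e +ᵥ e″)))))

module _ {p : ℕ} where
  open PrimePower p

  pair-cong : ∀ {a} (Λ : Laurent d) N {φ ψ} → (∀ u → a ⊢ φ u ℤ.- ψ u) → a ⊢ pair Λ N φ ℤ.- pair Λ N ψ
  pair-cong []            N h = ⊢-0
  pair-cong ((e , x) ∷ Λ) N {φ} {ψ} h =
    ⊢-≡ (regroup (x N) (φ e) (ψ e) (pair Λ N φ) (pair Λ N ψ)) (⊢-+ (⊢-*ˡ (x N) (h e)) (pair-cong Λ N h))
    where
    regroup : ∀ x f g s t → x ℤ.* (f ℤ.- g) ℤ.+ (s ℤ.- t) ≡ x ℤ.* f ℤ.+ s ℤ.- (x ℤ.* g ℤ.+ t)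
    regroup = ℤR.solve-∀

sumOver : List (Vec ℤ d) → (Vec ℤ d → ℤ) → ℤ
sumOver []      f = + 0
sumOver (e ∷ E) f = f e ℤ.+ sumOver E f

sumOver-zero : ∀ (E : List (Vec ℤ d)) → sumOver E (λ _ → + 0) ≡ + 0
sumOver-zero []      = refl
sumOver-zero (e ∷ E) = trans (ℤₚ.+-identityˡ _) (sumOver-zero E)

sumOver-cong : ∀ {E : List (Vec ℤ d)} {f g} → All (λ e → f e ≡ g e) E → sumOver E f ≡ sumOver E g
sumOver-cong []         = refl
sumOver-cong (eq ∷ eqs) = cong₂ ℤ._+_ eq (sumOver-cong eqs)

sumOver-+ : ∀ (E : List (Vec ℤ d)) f g → sumOver E (λ e → f e ℤ.+ g e) ≡ sumOver E f ℤ.+ sumOver E g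
sumOver-+ []      f g = refl
sumOver-+ (e ∷ E) f g = trans (cong (λ t → f e ℤ.+ g e ℤ.+ t) (sumOver-+ E f g))
  (regroup (f e) (g e) (sumOver E f) (sumOver E g))
  where
  regroup : ∀ a b s t → a ℤ.+ b ℤ.+ (s ℤ.+ t) ≡ a ℤ.+ s ℤ.+ (b ℤ.+ t)
  regroup = ℤR.solve-∀

sumOver-indicator : ∀ {E : List (Vec ℤ d)} {u} → Unique E → u ∈ E → ∀ x (ψ : Vec ℤ d → ℤ) →
  sumOver E (λ e → x ℤ.* indicator e u ℤ.* ψ e) ≡ x ℤ.* ψ u
sumOver-indicator {E = e ∷ E} {u} (e∉ ∷ uniq) (here refl) x ψ = trans
  (cong₂ ℤ._+_
    (trans (cong (λ b → x ℤ.* (if b then + 1 else + 0) ℤ.* ψ u) (dec-true (u ≟ᵥ u) refl))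
           (cong (ℤ._* ψ u) (ℤₚ.*-identityʳ x)))
    (trans (sumOver-cong (All.map vanish e∉)) (sumOver-zero E)))
  (ℤₚ.+-identityʳ (x ℤ.* ψ u))
  where
  vanish : ∀ {e} → u ≢ e → x ℤ.* indicator e u ℤ.* ψ e ≡ + 0
  vanish {e} u≢e = trans (cong (λ b → x ℤ.* (if b then + 1 else + 0) ℤ.* ψ e) (dec-false (u ≟ᵥ e) u≢e))
    (trans (cong (ℤ._* ψ e) (ℤₚ.*-zeroʳ x)) (ℤₚ.*-zeroˡ (ψ e)))
sumOver-indicator {E = e ∷ E} {u} (e∉ ∷ uniq) (there u∈E) x ψ = trans
  (cong₂ ℤ._+_
    (trans (cong (λ b → x ℤ.* (if b then + 1 else + 0) ℤ.* ψ e) (dec-false (u ≟ᵥ e) (λ eq → All.lookup e∉ u∈E (sym eq))))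
      (trans (cong (ℤ._* ψ e) (ℤₚ.*-zeroʳ x)) (ℤₚ.*-zeroˡ (ψ e))))
    (sumOver-indicator uniq u∈E x ψ))
  (ℤₚ.+-identityˡ (x ℤ.* ψ u))

-- A formal sum may list an exponent several times with cancelling coefficients, whereas the support
-- refers to the total coefficient; like terms are collected here.
pair-sumOver : ∀ {E : List (Vec ℤ d)} → Unique E → (Λ : Laurent d) → All (λ t → proj₁ t ∈ E) Λ →
  ∀ N ψ → pair Λ N ψ ≡ sumOver E (λ e → coeffL Λ e N ℤ.* ψ e)
pair-sumOver {E = E} uniq [] [] N ψ = sym (trans (sumOver-cong (All.universal (λ e → ℤₚ.*-zeroˡ (ψ e)) E)) (sumOver-zero E))
pair-sumOver {E = E} uniq ((u , x) ∷ Λ) (u∈E ∷ Λ⊆E) N ψ = begin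
  x N ℤ.* ψ u ℤ.+ pair Λ N ψ
    ≡⟨ cong₂ ℤ._+_ (sym (sumOver-indicator uniq u∈E (x N) ψ)) (pair-sumOver uniq Λ Λ⊆E N ψ) ⟩
  sumOver E (λ e → x N ℤ.* indicator e u ℤ.* ψ e) ℤ.+ sumOver E (λ e → coeffL Λ e N ℤ.* ψ e)
    ≡⟨ sumOver-+ E _ _ ⟨
  sumOver E (λ e → x N ℤ.* indicator e u ℤ.* ψ e ℤ.+ coeffL Λ e N ℤ.* ψ e)
    ≡⟨ sumOver-cong (All.universal (λ e → trans (sym (ℤₚ.*-distribʳ-+ (ψ e) (x N ℤ.* indicator e u) (coeffL Λ e N)))
         (cong (ℤ._* ψ e) (head e))) E) ⟩
  sumOver E (λ e → coeffL ((u , x) ∷ Λ) e N ℤ.* ψ e) ∎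
  where
  open ≡-Reasoning
  head : ∀ e → x N ℤ.* indicator e u ℤ.+ coeffL Λ e N ≡ coeffL ((u , x) ∷ Λ) e N
  head e = trans (cong (λ t → x N ℤ.* indicator e u ℤ.+ t) (coeffL-pair Λ e N)) (sym (coeffL-pair ((u , x) ∷ Λ) e N))

act-++ : ∀ (M M′ : List (Vec ℤ d)) φ u → act (M ++ M′) φ u ≡ act M φ u + act M′ φ u
act-++ []      M′ φ u = refl
act-++ (e ∷ M) M′ φ u = trans (cong (λ t → φ (u +ᵥ e) + t) (act-++ M M′ φ u)) (sym (+-assoc (φ (u +ᵥ e)) _ _))

act-replicate : ∀ n (e : Vec ℤ d) φ u → act (List.replicate n e) φ u ≡ n * φ (u +ᵥ e)
act-replicate zero    e φ u = refl
act-replicate (suc n) e φ u = cong (λ t → φ (u +ᵥ e) + t) (act-replicate n e φ u)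

module Reduction {p : ℕ} (pr : Prime p) (Λ : Laurent d) (N : ℕ) where
  open PrimePower p

  private instance
    p^N≢0 : NonZero (p ^ N)
    p^N≢0 = m^n≢0 p N {{prime⇒nonZero pr}}

  exponents : List (Vec ℤ d)
  exponents = List.deduplicate _≟ᵥ_ (List.map proj₁ Λ)

  multiplicity : Vec ℤ d → ℕ
  multiplicity e = coeffL Λ e N ℤD.%ℕ (p ^ N)

  multisetOn : List (Vec ℤ d) → List (Vec ℤ d)
  multisetOn = List.concatMap (λ e → List.replicate (multiplicity e) e)

  -- Merging the terms of Λ with equal exponents and reducing the coefficients modulo p^N
  -- leaves only exponents of the p-adic support, each repeated according to its residue.
  multiset : List (Vec ℤ d)
  multiset = multisetOn exponents

  -- A coefficient that is zero p-adically has residue 0 at level N. So the reduction creates no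
  -- exponents outside the support, and the Newton polyhedron condition on Λ applies to the
  -- multiset.
  multiplicity-supp : ∀ e → multiplicity e ≢ 0 → InSupp p Λ e
  multiplicity-supp e ≢0 ≈0 = ≢0 (remainder (multiplicity e) (ℤD.n%ℕd<d (coeffL Λ e N) (p ^ N))
    (⊢-+-cancelʳ (⊢-≡ (trans (ℤₚ.+-identityʳ _) (ℤD.a≡a%ℕn+[a/ℕn]*n (coeffL Λ e N) (p ^ N))) (mk (ℤS.∣ᵤ⇒∣ (≈0 N))))
      (mk (ℤS.divides (coeffL Λ e N ℤD./ℕ (p ^ N)) refl))))
    where
    remainder : ∀ k → k < p ^ N → N ⊢ + k → k ≡ 0
    remainder zero    _  _      = refl
    remainder (suc k) k< (mk h) = ⊥-elim (<⇒≱ k< (∣⇒≤ (ℤS.∣⇒∣ᵤ h)))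

  multiset-supp : All (InSupp p Λ) multiset
  multiset-supp = go exponents
    where
    go : ∀ E → All (InSupp p Λ) (multisetOn E)
    go []      = []
    go (e ∷ E) = Allₚ.++⁺ (copies (multiplicity e) refl) (go E)
      where
      copies : ∀ n → n ≡ multiplicity e → All (InSupp p Λ) (List.replicate n e)
      copies zero    _  = []
      copies (suc n) eq = Allₚ.replicate⁺ (suc n) (multiplicity-supp e (λ ≡0 → 1+n≢0 (trans eq ≡0)))

  pair-act : ∀ φ u → N ⊢ pair Λ N (λ e → + φ (u +ᵥ e)) ℤ.- + act multiset φ u
  pair-act φ u = ⊢-≡ (cong (λ t → t ℤ.- + act multiset φ u)
      (sym (pair-sumOver (deduplicate-! _≟ᵥ_ _) Λ
        (All.tabulate (λ t∈Λ → ∈-deduplicate⁺ _≟ᵥ_ (∈-map⁺ proj₁ t∈Λ))) N (λ e → + φ (u +ᵥ e)))))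
    (go exponents)
    where
    go : ∀ E → N ⊢ sumOver E (λ e → coeffL Λ e N ℤ.* + φ (u +ᵥ e)) ℤ.- + act (multisetOn E) φ u
    go []      = ⊢-0
    go (e ∷ E) = ⊢-≡ (sym value) (⊢-+ {x = q ℤ.* + (p ^ N) ℤ.* + x} (⊢-*ʳ (+ x) (mk (ℤS.divides q refl))) (go E))
      where
      q : ℤ
      q = coeffL Λ e N ℤD./ℕ (p ^ N)
      x k s : ℕ
      x = φ (u +ᵥ e)
      k = multiplicity e
      s = act (multisetOn E) φ u
      S : ℤ
      S = sumOver E (λ e → coeffL Λ e N ℤ.* + φ (u +ᵥ e))
      regroup : ∀ k r x s t → (k ℤ.+ r) ℤ.* x ℤ.+ s ℤ.- (k ℤ.* x ℤ.+ t) ≡ r ℤ.* x ℤ.+ (s ℤ.- t)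
      regroup = ℤR.solve-∀
      value : coeffL Λ e N ℤ.* + x ℤ.+ S ℤ.- + act (multisetOn (e ∷ E)) φ u ≡
              q ℤ.* + (p ^ N) ℤ.* + x ℤ.+ (S ℤ.- + s)
      value = trans (cong₂ (λ a b → a ℤ.* + x ℤ.+ S ℤ.- b) (ℤD.a≡a%ℕn+[a/ℕn]*n (coeffL Λ e N) (p ^ N))
          (trans (cong +_ (trans (act-++ (List.replicate k e) (multisetOn E) φ u) (cong (_+ s) (act-replicate k e φ u))))
            (trans (ℤₚ.pos-+ (k * x) s) (cong (ℤ._+ + s) (ℤₚ.pos-* k x)))))
        (regroup (+ k) (q ℤ.* + (p ^ N)) (+ x) S (+ s))

  -- The function φ has to vary: the last factor of the power is absorbed into it before the
  -- induction hypothesis is applied.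
  pair-powL : ∀ n φ → N ⊢ pair (powL Λ n) N (λ e → + φ e) ℤ.- + pow multiset n φ 0ᵥ
  pair-powL zero φ = ⊢-≡ (sym (value (+ φ 0ᵥ))) ⊢-0
    where
    value : ∀ x → + 1 ℤ.* x ℤ.+ + 0 ℤ.- x ≡ + 0
    value = ℤR.solve-∀
  pair-powL (suc n) φ = ⊢-≡ (trans (telescope (pair (powL Λ n) N (λ e → pair Λ N (λ e′ → + φ (e +ᵥ e′)))) _ _)
      (cong (λ t → t ℤ.- + pow multiset (suc n) φ 0ᵥ) (sym (pair-mulL (powL Λ n) Λ N (λ e → + φ e)))))
    (⊢-+ (pair-cong (powL Λ n) N (pair-act φ)) (pair-powL n (act multiset φ)))
    where
    telescope : ∀ a b c → a ℤ.- b ℤ.+ (b ℤ.- c) ≡ a ℤ.- c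
    telescope = ℤR.solve-∀

  seqA-reduction : ∀ n → N ⊢ seqA Λ n N ℤ.- + pow multiset n δ 0ᵥ
  seqA-reduction n = ⊢-≡ (cong (λ t → t ℤ.- + pow multiset n δ 0ᵥ)
      (trans (pair-≡ (powL Λ n)) (sym (coeffL-pair (powL Λ n) 0ᵥ N))))
    (pair-powL n δ)
    where
    choose : ∀ b → + (if b then 1 else 0) ≡ (if b then + 1 else + 0)
    choose true  = refl
    choose false = refl
    pair-≡ : ∀ Λ → pair Λ N (λ e → + δ e) ≡ pair Λ N (indicator 0ᵥ)
    pair-≡ []            = refl
    pair-≡ ((e , x) ∷ Λ) = cong₂ (λ a b → x N ℤ.* a ℤ.+ b) (choose (does (e ≟ᵥ 0ᵥ))) (pair-≡ Λ)

-- Differential operators modulo p^N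

eval-+ₚ : ∀ P Q x N → eval (P +ₚ Q) x N ≡ eval P x N ℤ.+ eval Q x N
eval-+ₚ []      Q       x N = sym (ℤₚ.+-identityˡ _)
eval-+ₚ (a ∷ P) []      x N = sym (ℤₚ.+-identityʳ _)
eval-+ₚ (a ∷ P) (b ∷ Q) x N = trans (cong (λ t → a N ℤ.+ b N ℤ.+ x N ℤ.* t) (eval-+ₚ P Q x N))
  (regroup (a N) (b N) (x N) (eval P x N) (eval Q x N))
  where
  regroup : ∀ a b x s t → a ℤ.+ b ℤ.+ x ℤ.* (s ℤ.+ t) ≡ a ℤ.+ x ℤ.* s ℤ.+ (b ℤ.+ x ℤ.* t)
  regroup = ℤR.solve-∀

eval-scaleₚ : ∀ c P x N → eval (scaleₚ c P) x N ≡ c N ℤ.* eval P x N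
eval-scaleₚ c []      x N = sym (ℤₚ.*-zeroʳ (c N))
eval-scaleₚ c (a ∷ P) x N = trans (cong (λ t → c N ℤ.* a N ℤ.+ x N ℤ.* t) (eval-scaleₚ c P x N))
  (regroup (c N) (a N) (x N) (eval P x N))
  where
  regroup : ∀ c a x s → c ℤ.* a ℤ.+ x ℤ.* (c ℤ.* s) ≡ c ℤ.* (a ℤ.+ x ℤ.* s)
  regroup = ℤR.solve-∀

eval-*ₚ : ∀ P Q x N → eval (P *ₚ Q) x N ≡ eval P x N ℤ.* eval Q x N
eval-*ₚ []      Q x N = sym (ℤₚ.*-zeroˡ (eval Q x N))
eval-*ₚ (a ∷ P) Q x N = trans (eval-+ₚ (scaleₚ a Q) (0p ∷ (P *ₚ Q)) x N)
  (trans (cong₂ (λ s t → s ℤ.+ (+ 0 ℤ.+ x N ℤ.* t)) (eval-scaleₚ a Q x N) (eval-*ₚ P Q x N))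
    (regroup (a N) (x N) (eval P x N) (eval Q x N)))
  where
  regroup : ∀ a x s t → a ℤ.* t ℤ.+ (+ 0 ℤ.+ x ℤ.* (s ℤ.* t)) ≡ (a ℤ.+ x ℤ.* s) ℤ.* t
  regroup = ℤR.solve-∀

eval-X+ : ∀ i x N → eval (X+ i) (cst (+ x)) N ≡ + (x + i)
eval-X+ i x N = trans (value (+ i) (+ x)) (sym (ℤₚ.pos-+ x i))
  where
  value : ∀ i x → i ℤ.+ x ℤ.* (+ 1 ℤ.+ x ℤ.* + 0) ≡ x ℤ.+ i
  value = ℤR.solve-∀

nth-length : ∀ L {k} → length L ≤ k → nth L k ≡ []
nth-length []      _         = refl
nth-length (P ∷ L) (s≤s len) = nth-length L len

applyOpFrom-sum : ∀ k L f m N → applyOpFrom k L f m N ≡ sumℤ (length L) (λ i →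
  if does (k + i ≤? m) then eval (nth L i) (cst (+ (m ∸ (k + i)))) N ℤ.* f (m ∸ (k + i)) N else + 0)
applyOpFrom-sum k []      f m N = refl
applyOpFrom-sum k (P ∷ L) f m N = cong₂ ℤ._+_
  (trans (choose (does (k ≤? m)))
    (cong (λ j → if does (j ≤? m) then eval P (cst (+ (m ∸ j))) N ℤ.* f (m ∸ j) N else + 0) (sym (+-identityʳ k))))
  (trans (applyOpFrom-sum (suc k) L f m N) (sumℤ-cong (length L) (λ i →
    cong (λ j → if does (j ≤? m) then eval (nth L i) (cst (+ (m ∸ j))) N ℤ.* f (m ∸ j) N else + 0) (sym (+-suc k i)))))
  where
  choose : ∀ b → (if b then applyPθ P f (m ∸ k) else 0p) N ≡
                 (if b then eval P (cst (+ (m ∸ k))) N ℤ.* f (m ∸ k) N else + 0)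
  choose true  = refl
  choose false = refl
  sumℤ-cong : ∀ n {f g : ℕ → ℤ} → (∀ i → f i ≡ g i) → sumℤ n f ≡ sumℤ n g
  sumℤ-cong zero    eq = refl
  sumℤ-cong (suc n) eq = cong₂ ℤ._+_ (eq 0) (sumℤ-cong n (λ i → eq (suc i)))

module _ {p : ℕ} where
  open PrimePower p

  ≈⇒⊢ : ∀ x y → x ≈[ p ] y → ∀ N → N ⊢ x N ℤ.- y N
  ≈⇒⊢ x y x≈y N = mk (ℤS.∣ᵤ⇒∣ (x≈y N))

  eval-≈ : ∀ {P Q} → (∀ j → coeff P j ≈[ p ] coeff Q j) → ∀ x N → N ⊢ eval P x N ℤ.- eval Q x N
  eval-≈ {[]}    {[]}    h x N = ⊢-0
  eval-≈ {[]}    {b ∷ Q} h x N = ⊢-≡ (regroup (b N) (x N) (eval Q x N))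
    (⊢-+ (≈⇒⊢ 0p b (h 0) N) (⊢-*ˡ (x N) (eval-≈ {[]} {Q} (λ j → h (suc j)) x N)))
    where
    regroup : ∀ b x t → + 0 ℤ.- b ℤ.+ x ℤ.* (+ 0 ℤ.- t) ≡ + 0 ℤ.- (b ℤ.+ x ℤ.* t)
    regroup = ℤR.solve-∀
  eval-≈ {a ∷ P} {[]}    h x N = ⊢-≡ (regroup (a N) (x N) (eval P x N))
    (⊢-+ (≈⇒⊢ a 0p (h 0) N) (⊢-*ˡ (x N) (eval-≈ {P} {[]} (λ j → h (suc j)) x N)))
    where
    regroup : ∀ a x s → a ℤ.- + 0 ℤ.+ x ℤ.* (s ℤ.- + 0) ≡ a ℤ.+ x ℤ.* s ℤ.- + 0
    regroup = ℤR.solve-∀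
  eval-≈ {a ∷ P} {b ∷ Q} h x N = ⊢-≡ (regroup (a N) (b N) (x N) (eval P x N) (eval Q x N))
    (⊢-+ (≈⇒⊢ a b (h 0) N) (⊢-*ˡ (x N) (eval-≈ {P} {Q} (λ j → h (suc j)) x N)))
    where
    regroup : ∀ a b x s t → a ℤ.- b ℤ.+ x ℤ.* (s ℤ.- t) ≡ a ℤ.+ x ℤ.* s ℤ.- (b ℤ.+ x ℤ.* t)
    regroup = ℤR.solve-∀

  eval-periodic : ∀ P x y N → 1 ⊢ eval P (cst (+ (x + p * y))) N ℤ.- eval P (cst (+ x)) N
  eval-periodic []      x y N = ⊢-0
  eval-periodic (a ∷ P) x y N = ⊢-≡ (sym value)
    (⊢-+ {x = + (p * y) ℤ.* E} (⊢-*ʳ E (⊢-1 {+ (p * y)} (m∣m*n y))) (⊢-*ˡ (+ x) (eval-periodic P x y N)))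
    where
    E E′ : ℤ
    E  = eval P (cst (+ (x + p * y))) N
    E′ = eval P (cst (+ x)) N
    regroup : ∀ a x z s t → a ℤ.+ (x ℤ.+ z) ℤ.* s ℤ.- (a ℤ.+ x ℤ.* t) ≡ z ℤ.* s ℤ.+ x ℤ.* (s ℤ.- t)
    regroup = ℤR.solve-∀
    value : a N ℤ.+ + (x + p * y) ℤ.* E ℤ.- (a N ℤ.+ + x ℤ.* E′) ≡ + (p * y) ℤ.* E ℤ.+ + x ℤ.* (E ℤ.- E′)
    value = trans (cong (λ t → a N ℤ.+ t ℤ.* E ℤ.- (a N ℤ.+ + x ℤ.* E′)) (ℤₚ.pos-+ x (p * y)))
      (regroup (a N) (+ x) (+ (p * y)) E E′)

  divisible⇒factor : ∀ {D P} → PolyDivisible p D P → ∀ x N → ∃ λ q → N ⊢ eval P x N ℤ.- eval D x N ℤ.* q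
  divisible⇒factor {D} {P} (Q , _ , eq) x N =
    eval Q x N , ⊢-≡ (cong (λ t → eval P x N ℤ.- t) (eval-*ₚ D Q x N)) (eval-≈ {P} {D *ₚ Q} eq x N)

  -- The j multiples p(m+1), …, p(m+j) of p lie strictly between x and x + k + 1.
  prodSq-divisible : ∀ {x m} N k j → x < p * suc m → p * (m + j) < x + suc k →
    j + j ⊢ eval (prodSq (suc k)) (cst (+ x)) N
  prodSq-divisible N k zero x< <x+k = ⊢-zero
  prodSq-divisible {x} {m} N zero (suc j) x< <x+k = ⊥-elim (<-irrefl refl (begin-strict
    x                 <⟨ x< ⟩
    p * suc m         ≤⟨ *-monoʳ-≤ p (≤-trans (s≤s (m≤m+n m j)) (≤-reflexive (sym (+-suc m j)))) ⟩
    p * (m + suc j)   ≤⟨ ℕ.s≤s⁻¹ (subst (p * (m + suc j) <_) (+-comm x 1) <x+k) ⟩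
    x                 ∎))
    where open ≤-Reasoning
  prodSq-divisible {x} {m} N (suc k) (suc j) x< <x+k
    with m<1+n⇒m<n∨m≡n (subst (p * (m + suc j) <_) (+-suc x (suc k)) <x+k)
  ... | inj₁ lt = ⊢-≡ (sym (eval-*ₚ (prodSq (suc k)) _ (cst (+ x)) N))
          (⊢-*ʳ (eval (X+ (suc k) *ₚ X+ (suc k)) (cst (+ x)) N) (prodSq-divisible N k (suc j) x< lt))
  -- The largest multiple of p is the new linear factor itself; squared, it contributes 2, and the
  -- other j multiples occur in the earlier factors.
  ... | inj₂ eq = ⊢-≡ (sym (eval-*ₚ (prodSq (suc k)) _ (cst (+ x)) N)) (⊢-mono (≤-reflexive (count₂ j))
          (⊢-* (prodSq-divisible N k j x< (<-≤-trans (*-monoʳ-< p (+-monoʳ-< m (n<1+n j))) (≤-reflexive eq)))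
            (⊢-≡ (sym (eval-*ₚ (X+ (suc k)) (X+ (suc k)) (cst (+ x)) N)) (⊢-* {1} {1} factor factor))))
    where
    instance
      p≢0 : NonZero p
      p≢0 = ℕ.≢-nonZero λ { refl → n≮0 x< }
    count₂ : ∀ j → suc j + suc j ≡ j + j + (1 + 1)
    count₂ = solve-∀
    factor : 1 ⊢ eval (X+ (suc k)) (cst (+ x)) N
    factor = ⊢-≡ (sym (eval-X+ (suc k) x N)) (⊢-1 (subst (p ∣_) eq (m∣m*n (m + suc j))))

  -- The inverse of v modulo each p^k; coherence follows by cancelling v.
  natural-unit : Prime p → ∀ {v} → ¬ p ∣ v → IsUnit p (cst (+ v))
  natural-unit pr {v} p∤v = (λ k → proj₁ (inverse k)) , coherent , λ k → ℤS.∣⇒∣ᵤ (divisible (proj₂ (inverse k)))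
    where
    inverse : ∀ k → ∃ λ w → k ⊢ + v ℤ.* w ℤ.- + 1
    inverse k with coprime-Bézout (prime-power-coprime pr p∤v k)
    ... | Bézout.-+ x y eq = + y , mk (ℤS.divides (+ x) (begin
          + v ℤ.* + y ℤ.- + 1           ≡⟨ cong (ℤ._- + 1) (trans (sym (ℤₚ.pos-* v y)) (cong +_ (trans (*-comm v y) (sym eq)))) ⟩
          + (1 + x * p ^ k) ℤ.- + 1     ≡⟨ cong (ℤ._- + 1) (trans (ℤₚ.pos-+ 1 (x * p ^ k)) (cong (λ t → + 1 ℤ.+ t) (ℤₚ.pos-* x (p ^ k)))) ⟩
          + 1 ℤ.+ + x ℤ.* + (p ^ k) ℤ.- + 1   ≡⟨ drop (+ x ℤ.* + (p ^ k)) ⟩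
          + x ℤ.* + (p ^ k)             ∎))
      where
      open ≡-Reasoning
      drop : ∀ z → + 1 ℤ.+ z ℤ.- + 1 ≡ z
      drop = ℤR.solve-∀
    ... | Bézout.+- x y eq = ℤ.- + y , mk (ℤS.divides (ℤ.- + x) (begin
          + v ℤ.* (ℤ.- + y) ℤ.- + 1     ≡⟨ pull (+ v) (+ y) ⟩
          ℤ.- (+ 1 ℤ.+ + y ℤ.* + v)     ≡⟨ cong ℤ.-_ (trans (cong (λ t → + 1 ℤ.+ t) (sym (ℤₚ.pos-* y v))) (trans (sym (ℤₚ.pos-+ 1 (y * v))) (cong +_ eq))) ⟩
          ℤ.- + (x * p ^ k)             ≡⟨ cong ℤ.-_ (ℤₚ.pos-* x (p ^ k)) ⟩
          ℤ.- (+ x ℤ.* + (p ^ k))       ≡⟨ ℤₚ.neg-distribˡ-* (+ x) (+ (p ^ k)) ⟩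
          ℤ.- + x ℤ.* + (p ^ k)         ∎))
      where
      open ≡-Reasoning
      pull : ∀ v y → v ℤ.* (ℤ.- y) ℤ.- + 1 ≡ ℤ.- (+ 1 ℤ.+ y ℤ.* v)
      pull = ℤR.solve-∀
    coherent : IsZp p (λ k → proj₁ (inverse k))
    coherent k = ℤS.∣⇒∣ᵤ (divisible (⊢-cancel pr (+ v) p∤v
      (⊢-≡ (difference (+ v) (proj₁ (inverse (suc k))) (proj₁ (inverse k)))
        (⊢-- (⊢-mono (n≤1+n k) (proj₂ (inverse (suc k)))) (proj₂ (inverse k))))))
      where
      difference : ∀ v a b → v ℤ.* a ℤ.- + 1 ℤ.- (v ℤ.* b ℤ.- + 1) ≡ v ℤ.* (a ℤ.- b)
      difference = ℤR.solve-∀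

  unit-level : Prime p → ∀ {u} → IsUnit p u → ∀ {N} → 0 < N → ¬ p ∣ ℤ.∣ u N ∣
  unit-level pr {u} (v , _ , uv≈1) {N} 0<N p∣u = <⇒≢ (ℕ.nonTrivial⇒n>1 p {{prime⇒nonTrivial pr}})
    (sym (∣1⇒≡1 (⊢-1⁻¹ (⊢-≡ (cancel (u N ℤ.* v N))
      (⊢-- (⊢-*ʳ (v N) (⊢-1 {u N} p∣u)) (⊢-mono 0<N (≈⇒⊢ (u ⊗ v) 1p uv≈1 N)))))))
    where
    cancel : ∀ x → x ℤ.- (x ℤ.- + 1) ≡ + 1
    cancel = ℤR.solve-∀

-- Coherent sequences and the ideals generated by powers of p

module _ (p : ℕ) where
  open PrimePower p

  IsZp⇒⊢ : ∀ x → IsZp p x → ∀ k → k ⊢ x (suc k) ℤ.- x k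
  IsZp⇒⊢ x h k = mk (ℤS.∣ᵤ⇒∣ (h k))

  IsZp-⊕ : ∀ x y → IsZp p x → IsZp p y → IsZp p (x ⊕ y)
  IsZp-⊕ x y hx hy k = ℤS.∣⇒∣ᵤ (divisible (⊢-≡ (regroup (x (suc k)) (x k) (y (suc k)) (y k))
    (⊢-+ (IsZp⇒⊢ x hx k) (IsZp⇒⊢ y hy k))))
    where
    regroup : ∀ a b c d → a ℤ.- b ℤ.+ (c ℤ.- d) ≡ a ℤ.+ c ℤ.- (b ℤ.+ d)
    regroup = ℤR.solve-∀

  IsZp-⊗ : ∀ x y → IsZp p x → IsZp p y → IsZp p (x ⊗ y)
  IsZp-⊗ x y hx hy k = ℤS.∣⇒∣ᵤ (divisible (⊢-≡ (regroup (x (suc k)) (x k) (y (suc k)) (y k))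
    (⊢-+ (⊢-*ʳ (y (suc k)) (IsZp⇒⊢ x hx k)) (⊢-*ˡ (x k) (IsZp⇒⊢ y hy k)))))
    where
    regroup : ∀ a b c d → (a ℤ.- b) ℤ.* c ℤ.+ b ℤ.* (c ℤ.- d) ≡ a ℤ.* c ℤ.- b ℤ.* d
    regroup = ℤR.solve-∀

  IsZp-cst : ∀ z → IsZp p (cst z)
  IsZp-cst z k = subst (λ t → p ^ k ∣ ℤ.∣ t ∣) (sym (ℤₚ.+-inverseʳ z)) (_ ∣0)

  Coherent : Laurent d → Set
  Coherent = All (λ t → IsZp p (proj₂ t))

  mulL-coherent : {Λ Λ′ : Laurent d} → Coherent Λ → Coherent Λ′ → Coherent (mulL Λ Λ′)
  mulL-coherent {Λ = []}          []       h′ = []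
  mulL-coherent {Λ = (_ , x) ∷ _} (hx ∷ h) h′ =
    Allₚ.++⁺ (Allₚ.map⁺ (All.map (λ {t} → IsZp-⊗ x (proj₂ t) hx) h′)) (mulL-coherent h h′)

  powL-coherent : {Λ : Laurent d} → Coherent Λ → ∀ n → Coherent (powL Λ n)
  powL-coherent h zero    = IsZp-cst (+ 1) ∷ []
  powL-coherent h (suc n) = mulL-coherent (powL-coherent h n) h

  coeffL-coherent : ∀ {Λ : Laurent d} e → Coherent Λ → IsZp p (coeffL Λ e)
  coeffL-coherent e [] = IsZp-cst (+ 0)
  coeffL-coherent {Λ = (u , x) ∷ Λ} e (hx ∷ h) =
    IsZp-⊕ (if does (u ≟ᵥ e) then x else 0p) (coeffL Λ e) (choose (does (u ≟ᵥ e))) (coeffL-coherent e h)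
    where
    choose : ∀ b → IsZp p (if b then x else 0p)
    choose true  = hx
    choose false = IsZp-cst (+ 0)

  coherent-steps : ∀ x → IsZp p x → ∀ k a → k ⊢ x k ℤ.- x (k + a)
  coherent-steps x h k zero = ⊢-≡ (sym (trans (cong (λ t → x k ℤ.- x t) (+-identityʳ k)) (ℤₚ.+-inverseʳ (x k)))) ⊢-0
  coherent-steps x h k (suc a) = ⊢-≡ (trans (telescope (x k) (x (k + a)) (x (suc (k + a))))
      (cong (λ t → x k ℤ.- x t) (sym (+-suc k a))))
    (⊢-- (coherent-steps x h k a) (⊢-mono (m≤m+n k a) (IsZp⇒⊢ x h (k + a))))
    where
    telescope : ∀ a b c → a ℤ.- b ℤ.- (c ℤ.- b) ≡ a ℤ.- c
    telescope = ℤR.solve-∀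

  -- Dividing by p^a loses a levels of precision, so the quotient at level k is read off at level k
  -- + a.
  inPowIdeal : .{{_ : NonZero p}} → ∀ x a → IsZp p x → (∀ N → a ≤ N → a ⊢ x N) → InPowIdeal p a x
  inPowIdeal x a h p^a∣ = y , y-coherent , λ k → ℤS.∣⇒∣ᵤ (divisible (⊢-≡ (cong (λ t → x k ℤ.- t)
      (trans (value k) (ℤₚ.*-comm (y k) (+ (p ^ a))))) (coherent-steps x h k a)))
    where
    y : Zp
    y k = ℤS._∣_.quotient (divisible (p^a∣ (k + a) (m≤n+m a k)))
    value : ∀ k → x (k + a) ≡ y k ℤ.* + (p ^ a)
    value k = ℤS._∣_.equality (divisible (p^a∣ (k + a) (m≤n+m a k)))
    instance
      p^a≢0 : ℤ.NonZero (+ (p ^ a))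
      p^a≢0 = m^n≢0 p a
    y-coherent : IsZp p y
    y-coherent k = ℤS.∣⇒∣ᵤ (ℤS.*-cancelʳ-∣ (+ (p ^ a)) {+ (p ^ k)} {y (suc k) ℤ.- y k} (subst₂ ℤS._∣_
      (trans (cong +_ (^-distribˡ-+-* p k a)) (ℤₚ.pos-* (p ^ k) (p ^ a)))
      (trans (cong₂ ℤ._-_ (value (suc k)) (value k)) (sym (factor (y (suc k)) (y k) (+ (p ^ a)))))
      (divisible (IsZp⇒⊢ x h (k + a)))))
      where
      factor : ∀ a b c → (a ℤ.- b) ℤ.* c ≡ a ℤ.* c ℤ.- b ℤ.* c
      factor = ℤR.solve-∀

-- From lists of digits to digit counts

module _ (m : ℕ) {Z Z′ : ℕ → Set} (Z⇒Z′ : ∀ {v} → Z v → Z′ v) where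
  private
    p : ℕ
    p = suc (suc m)
  open DigitCount p Z′

  recompose : ∀ n → n % p + p * (n / p) ≡ n
  recompose n = sym (trans (m≡m%n+[m/n]*n n p) (cong (λ t → n % p + t) (*-comm (n / p) p)))

  digitsAux-≤α : ∀ f n {a} → CountIn Z (digitsAux m f n) a → a ≤α n
  digitsAux-≤α zero    n       cnil = none
  digitsAux-≤α (suc f) zero    cnil = none
  digitsAux-≤α (suc f) (suc n) {a} (cyes Zv h) = subst (a ≤α_) (recompose (suc n))
    (count (m%n<n (suc n) p) (Z⇒Z′ Zv) (digitsAux-≤α f _ h))
  digitsAux-≤α (suc f) (suc n) {a} (cno _ h) = subst (a ≤α_) (recompose (suc n))
    (skip (m%n<n (suc n) p) (digitsAux-≤α f _ h))

  digits-≤α : ∀ n {a} → CountIn Z (digits p n) a → a ≤α n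
  digits-≤α zero (cyes Z0 cnil) = subst (1 ≤α_) (*-zeroʳ p) (count {0} {0} (s≤s z≤n) (Z⇒Z′ Z0) none)
  digits-≤α zero (cno _ cnil)   = none
  digits-≤α (suc n) h           = digitsAux-≤α (suc n) (suc n) h

digits-prime-≤α : ∀ {p} → Prime p → ∀ {Z Z′ : ℕ → Set} → (∀ {v} → Z v → Z′ v) →
  ∀ n {a} → CountIn Z (digits p n) a → DigitCount._≤α_ p Z′ a n
digits-prime-≤α {zero}          pr     = ⊥-elim (¬prime[0] pr)
digits-prime-≤α {suc zero}      pr     = ⊥-elim (¬prime[1] pr)
digits-prime-≤α {suc (suc m)}   pr Z⇒Z′ = digits-≤α m Z⇒Z′

-- The argument at a fixed level N

module Level {p : ℕ} (pr : Prime p) (Λ : Laurent d) (newton : OriginOnlyInterior p Λ)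
  (L : Op) (annihilates : Annihilates p L (seqA Λ)) {N : ℕ} (0<N : 0 < N) where

  open PrimePower p
  open Reduction pr Λ N
  open Supercongruence pr multiset-supp (λ {r} {c} {u} → interior-multiple {p = p} {Λ} newton {r} {c} {u})

  private instance
    p≢0 : NonZero p
    p≢0 = prime⇒nonZero pr

  c : ℕ → ℕ → ℤ
  c k x = eval (nth L k) (cst (+ x)) N

  c-vanish : ∀ {k} x → length L ≤ k → c k x ≡ + 0
  c-vanish x len = cong (λ P → eval P (cst (+ x)) N) (nth-length L len)

  recurrence : ∀ n → N ⊢ sumℤ (length L) (term c (λ n → + A n) n)
  recurrence n = ⊢-≡ (cancel (sumℤ (length L) exact) (sumℤ (length L) (term c (λ n → + A n) n)))
    (⊢-- (⊢-≡ (trans (ℤₚ.+-identityʳ _) (applyOpFrom-sum 0 L (seqA Λ) n N))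
           (≈⇒⊢ (applyOp L (seqA Λ) n) 0p (annihilates n) N))
         (⊢-≡ (sumℤ-combine (length L) exact _ (+ 1)) (sumℤ-⊢ (length L) _ difference)))
    where
    exact : ℕ → ℤ
    exact = term c (λ n → seqA Λ n N) n
    cancel : ∀ a b → a ℤ.- (a ℤ.- b ℤ.* + 1) ≡ b
    cancel = ℤR.solve-∀
    difference : ∀ k → N ⊢ exact k ℤ.- term c (λ n → + A n) n k ℤ.* + 1
    difference k = choose (does (k ≤? n))
      where
      factor : ∀ c a b → c ℤ.* (a ℤ.- b) ≡ c ℤ.* a ℤ.- c ℤ.* b ℤ.* + 1
      factor = ℤR.solve-∀
      choose : ∀ b → N ⊢ (if b then c k (n ∸ k) ℤ.* seqA Λ (n ∸ k) N else + 0) ℤ.-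
                         (if b then c k (n ∸ k) ℤ.* + A (n ∸ k) else + 0) ℤ.* + 1
      choose true  = ⊢-≡ (factor (c k (n ∸ k)) (seqA Λ (n ∸ k) N) (+ A (n ∸ k)))
                       (⊢-*ˡ (c k (n ∸ k)) (seqA-reduction (n ∸ k)))
      choose false = ⊢-0

  zeroSet⇒∣A : ∀ {v} → InZeroSet p (seqA Λ) v → p ∣ A v
  zeroSet⇒∣A {v} (_ , y , _ , eq) = ⊢-1⁻¹ (⊢-≡ (cancel (seqA Λ v N) (+ (p ^ 1) ℤ.* y N) (+ A v))
    (⊢-+ (⊢-- (⊢-mono 0<N (≈⇒⊢ (seqA Λ v) (cst (+ (p ^ 1)) ⊗ y) eq N)) (⊢-mono 0<N (seqA-reduction v)))
         (⊢-*ʳ (y N) (mk {1} ℤS.∣-refl))))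
    where
    cancel : ∀ a b c → a ℤ.- b ℤ.- (a ℤ.- c) ℤ.+ b ≡ c
    cancel = ℤR.solve-∀

  unit : UnitPreserving p (nth L 0) → ∀ v → 0 < v → v < p → ¬ p ∣ ℤ.∣ c 0 v ∣
  unit preserving v@(suc _) _ v<p = unit-level pr {eval (nth L 0) (cst (+ v))}
    (preserving (cst (+ v)) (IsZp-cst p (+ v)) (natural-unit pr (λ p∣v → <⇒≱ v<p (∣⇒≤ p∣v)))) 0<N

  -- For n = v + pm, the summands P_k(n - k) A(n - k) with n - k < pm are negligible.
  Killed : Set
  Killed = ∀ {a m} k v → a ≤α m → suc a ≤ N → 0 < v → v < p → v < k → k ≤ v + p * m →
    (∀ x b → x < v + p * m → b ≤ N → b ≤α x → b ⊢ + A x) →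
    suc a ⊢ c k (v + p * m ∸ k) ℤ.* + A (v + p * m ∸ k)

  killed-factor : ∀ {a k x D} → suc a ≤ N → PolyDivisible p D (nth L k) →
    (∀ q → suc a ⊢ eval D (cst (+ x)) N ℤ.* q ℤ.* + A x) → suc a ⊢ c k x ℤ.* + A x
  killed-factor {k = k} {x} {D} a<N divisible′ h with divisible⇒factor {D = D} {nth L k} divisible′ (cst (+ x)) N
  ... | q , h′ = ⊢-≡ (split (c k x) (eval D (cst (+ x)) N ℤ.* q) (+ A x)) (⊢-+ (⊢-*ʳ (+ A x) (⊢-mono a<N h′)) (h q))
    where
    split : ∀ c e a → (c ℤ.- e) ℤ.* a ℤ.+ e ℤ.* a ≡ c ℤ.* a
    split = ℤR.solve-∀

  killed-vanish : ∀ {a k x} → length L ≤ k → suc a ⊢ c k x ℤ.* + A x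
  killed-vanish {x = x} len = ⊢-≡ (sym (trans (cong (ℤ._* + A x) (c-vanish x len)) (ℤₚ.*-zeroˡ (+ A x)))) ⊢-0

  -- Let x = v + pm - k and y = x / p. The linear factors of `prodSq k` at x run through x + 1, ...,
  -- x + k - 1, and the j = m - y multiples p(y + 1), ..., pm of p are among them, the last one
  -- because v > 0. Meanwhile α(x) ≥ α(y) ≥ α(m) - j.
  killed-I : (∀ k → 2 ≤ k → k ≤ ordZ L → PolyDivisible p (prodSq k) (nth L k)) → Killed
  killed-I divisible′ {a} {m} k@(suc k′) v h a<N 0<v v<p v<k k≤ ih with k ≤? ordZ L
  ... | no k≰  = killed-vanish (≤-trans (m≤n+m∸n (length L) 1) (≰⇒> k≰))
  ... | yes k≤q = killed-factor {D = prodSq k} a<N (divisible′ k (≤-trans (s≤s 0<v) v<k) k≤q)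
      λ q → ⊢-mono exponent (⊢-* (⊢-*ʳ q (prodSq-divisible N k′ j x<next below)) p^∣A)
    where
    open ≤-Reasoning
    x y j : ℕ
    x = v + p * m ∸ k
    y = x / p
    j = m ∸ y
    x+k : x + k ≡ v + p * m
    x+k = m∸n+n≡m k≤
    x≡ : x ≡ x % p + p * y
    x≡ = trans (m≡m%n+[m/n]*n x p) (cong (λ t → x % p + t) (*-comm y p))
    x<next : x < p * suc y
    x<next = begin-strict
      x              ≡⟨ x≡ ⟩
      x % p + p * y  <⟨ +-monoˡ-< (p * y) (m%n<n x p) ⟩
      p + p * y      ≡⟨ *-suc p y ⟨
      p * suc y      ∎
    y<m : y < m
    y<m = *-cancelˡ-< p y m (begin-strict
      p * y          ≤⟨ m≤n+m (p * y) (x % p) ⟩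
      x % p + p * y  ≡⟨ x≡ ⟨
      x              <⟨ +-cancelʳ-< k x (p * m) (begin-strict
                          x + k       ≡⟨ x+k ⟩
                          v + p * m   <⟨ +-monoˡ-< (p * m) v<k ⟩
                          k + p * m   ≡⟨ +-comm k (p * m) ⟩
                          p * m + k   ∎) ⟩
      p * m          ∎)
    y+j : y + j ≡ m
    y+j = m+[n∸m]≡n (<⇒≤ y<m)
    below : p * (y + j) < x + k
    below = begin-strict
      p * (y + j)  ≡⟨ cong (p *_) y+j ⟩
      p * m        <⟨ +-monoˡ-< (p * m) 0<v ⟩
      v + p * m    ≡⟨ x+k ⟨
      x + k        ∎
    p^∣A : (a ∸ j) ⊢ + A x
    p^∣A = ih x (a ∸ j) (∸-monoʳ-< (s≤s z≤n) k≤) (≤-trans (m∸n≤m a j) (<⇒≤ a<N))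
      (subst ((a ∸ j) ≤α_) (sym x≡) (skip (m%n<n x p) (≤α-∸ p∤A0 j (subst (a ≤α_) (sym y+j) h))))
    -- Each multiple of p gains 2 through its square and loses at most 1 in α; y < m makes j ≥ 1, so
    -- the balance is at least a + 1.
    exponent : suc a ≤ j + j + (a ∸ j)
    exponent = begin
      suc a              ≤⟨ +-mono-≤ (m<n⇒0<n∸m y<m) (m≤n+m∸n a j) ⟩
      j + (j + (a ∸ j))  ≡⟨ +-assoc j j (a ∸ j) ⟨
      j + j + (a ∸ j)    ∎

  -- As P_k = 0 for k ≥ 3, the inequalities 0 < v < k leave only k = 2, v = 1, with index pm - 1 for
  -- m ≥ 1. There X + 1 takes the value pm.
  killed-II : length L ≡ 3 → PolyDivisible p (X+ 1) (nth L 2) → p ∣ A (p ∸ 1) → Killed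
  killed-II len divisible′ Z k@(suc (suc (suc _))) v h a<N 0<v v<p v<k k≤ ih =
    killed-vanish (≤-trans (≤-reflexive len) (s≤s (s≤s (s≤s z≤n))))
  killed-II len divisible′ Z 1 (suc v) h a<N 0<v v<p (s≤s ()) k≤ ih
  killed-II len divisible′ Z 2 (suc (suc v)) h a<N 0<v v<p (s≤s (s≤s ())) k≤ ih
  killed-II len divisible′ Z {a} {zero} 2 1 h a<N 0<v v<p v<k k≤ ih
    with s≤s () ← subst (λ t → 2 ≤ 1 + t) (*-zeroʳ p) k≤
  killed-II len divisible′ Z {a} {suc m} 2 1 h a<N 0<v v<p v<k k≤ ih = killed-factor {D = X+ 1} a<N divisible′
    λ q → ⊢-* {1} {a} (⊢-*ʳ q p∣x+1) (p^a∣A a (<⇒≤ a<N) h)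
    where
    x : ℕ
    x = p * suc m ∸ 1
    x+1 : x + 1 ≡ p * suc m
    x+1 = m∸n+n≡m (ℕ.s≤s⁻¹ k≤)
    x≡ : p ∸ 1 + p * m ≡ x
    x≡ = trans (sym (+-∸-comm (p * m) (<⇒≤ 1<p))) (cong (_∸ 1) (sym (*-suc p m)))
    p∣x+1 : 1 ⊢ eval (X+ 1) (cst (+ x)) N
    p∣x+1 = ⊢-≡ (sym (eval-X+ 1 x N)) (⊢-1 (subst (p ∣_) (sym x+1) (m∣m*n (suc m))))
    p^a∣A : ∀ a → a ≤ N → a ≤α suc m → a ⊢ + A x
    p^a∣A zero    _   _ = ⊢-zero
    -- Lowering the prefix by one may lose one counted digit; the last digit p - 1 of x, counted by
    -- hypothesis, makes up for it.
    p^a∣A (suc a) a≤N h = ih x (suc a) (s≤s (m∸n≤m (p * suc m) 1)) a≤N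
      (subst (suc a ≤α_) x≡ (count (∸-monoʳ-< (s≤s z≤n) (<⇒≤ 1<p)) Z (≤α-pred₂ p∤A0 h refl)))

  p^α∣seqA : ∀ {K} → length L ≡ suc K → UnitPreserving p (nth L 0) → Killed →
    ∀ {n a} → a ≤ N → AlphaIs p (seqA Λ) n a → a ⊢ seqA Λ n N
  p^α∣seqA {K} len preserving killed {n} {a} a≤N α =
    ⊢-+-cancelʳ {y = ℤ.- + A n} (⊢-mono a≤N (seqA-reduction n))
      (⊢-≡ (ℤₚ.+-identityˡ (ℤ.- + A n)) (⊢-- ⊢-0 (p^α∣A c {N} {K}
        (λ k x y → eval-periodic (nth L k) x y N) (unit preserving)
        (λ n → subst (λ l → N ⊢ sumℤ l (term c (λ n → + A n) n)) len (recurrence n)) killed a≤N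
        (digits-prime-≤α pr zeroSet⇒∣A n α))))

type⇒preserving : ∀ {p L} {B : Set} → TypeI p L ⊎ (TypeII p L × B) → UnitPreserving p (nth L 0)
type⇒preserving (inj₁ (preserving , _))           = preserving
type⇒preserving (inj₂ ((_ , preserving , _) , _)) = preserving

-- Each level N ≥ a is treated with its own multiset; the levels meet only in `inPowIdeal`, where
-- coherence of the original sequence assembles the quotient.
theorem2 : (p : ℕ) → Prime p → (d : ℕ) → (Λ : Laurent d)
    → All (λ t → IsZp p (proj₂ t)) Λ
    → OriginOnlyInterior p Λ
    → (L : Op) → All (All (IsZp p)) L
    → Annihilates p L (seqA Λ)
    → (TypeI p L ⊎ (TypeII p L × InZeroSet p (seqA Λ) (p ∸ 1)))
    → (n a : ℕ) → AlphaIs p (seqA Λ) n a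
    → InPowIdeal p a (seqA Λ n)
-- The empty operator has P_0 = 0, which does not send the unit 1 to a unit.
theorem2 p pr d Λ coherent newton [] _ annihilates type n a α =
  ⊥-elim (unit-level pr {0p} (type⇒preserving {p} {[]} type 1p (IsZp-cst p (+ 1)) (1p , IsZp-cst p (+ 1) , λ k → _ ∣0))
    {1} (s≤s z≤n) (p ∣0))
theorem2 p pr d Λ coherent newton L@(_ ∷ _) _ annihilates type n a α =
  inPowIdeal p {{prime⇒nonZero pr}} (seqA Λ n) a (coeffL-coherent p 0ᵥ (powL-coherent p coherent n)) level
  where
  open PrimePower p
  level : ∀ N → a ≤ N → a ⊢ seqA Λ n N
  -- Level 0 carries no information modulo p, so `Level` requires N > 0; here a = 0.
  level zero    z≤n = ⊢-zero
  level (suc N) a≤N = p^α∣seqA refl (type⇒preserving {p} {L} type) (killed type) a≤N α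
    where
    open Level pr Λ newton L annihilates {suc N} (s≤s z≤n)
    killed : TypeI p L ⊎ (TypeII p L × InZeroSet p (seqA Λ) (p ∸ 1)) → Killed
    killed (inj₁ (_ , divisible′))             = killed-I divisible′
    killed (inj₂ ((len , _ , divisible′) , Z)) = killed-II len divisible′ (zeroSet⇒∣A Z)
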